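{- Let $\kappa$ be a regular uncountable cardinal and $\lambda>\kappa$ a cardinal. Suppose that $\theta$ is an infinite cardinal $<\kappa$ such that $\kappa\to(\kappa,\theta)^2$, and $H$ is an ideal on $P_\kappa(\lambda)$ with $\mathrm{cof}(H)<\mathbf{non}_\kappa(\text{weakly selective})$. Then $H^+\xrightarrow[\kappa]{\kappa}(H^+,\theta+1)^2$.
   Context: For a cardinal $\mu$ and a set $A$, $P_\mu(A)=\{a\subseteq A:|a|<\mu\}$. An ideal on an infinite set $S$ is a collection $K$ of subsets of $S$ containing all singletons, closed under subsets and finite unions, with $S\notin K$; $K^+=P(S)\setminus K$; $K|A=\{B\subseteq S:B\cap A\in K\}$ for $A\in K^+$; $\mathrm{cof}(K)$ is the least cardinality of an $X\subseteq K$ with $K=\bigcup_{A\in X}P(A)$. $K$ is $\kappa$-complete if it is closed under unions of fewer than $\kappa$ members. "Ideal on $\kappa$" always means $\kappa$-complete ideal on $\kappa$. $I_{\kappa,\lambda}$ is the set of all $A\subseteq P_\kappa(\lambda)$ such that $A\cap\{b\in P_\kappa(\lambda):a\subseteq b\}=\emptyset$ for some $a\in P_\kappa(\lambda)$. "Ideal on $P_\kappa(\lambda)$" always means a $\kappa$-complete ideal $H$ on $P_\kappa(\lambda)$ that is fine ($I_{\kappa,\lambda}\subseteq H$). For $A\subseteq\kappa$, $[A]^2=\{(\xi,\eta)\in A\times A:\xi<\eta\}$. $\kappa\to(\kappa,\alpha)^2$ means: for every $f:[\kappa]^2\to 2$ there is $A\subseteq\kappa$ such that either $A$ has order type $\kappa$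 and $f$ is identically $0$ on $[A]^2$, or $A$ has order type $\alpha$ and $f$ is identically $1$ on $[A]^2$. An ideal $J$ on $\kappa$ is a weak $P$-point if for every $A\in J^+$ and $f\in{}^A\kappa$ with $\{f^{ -1}(\{\alpha\}):\alpha<\kappa\}\subseteq J$ there is $B\in J^+\cap P(A)$ such that $f$ is $<\kappa$-to-one on $B$. $J$ is a local $Q$-point if for every $g\in{}^\kappa\kappa$ there is $B\in J^+$ such that $g(\alpha)<\beta$ for all $(\alpha,\beta)\in[B]^2$; $J$ is a weak $Q$-point if $J|A$ is a local $Q$-point for every $A\in J^+$. $J$ is weakly selective if it is both a weak $P$-point and a weak $Q$-point. $\mathbf{non}_\kappa(\text{weakly selective})$ is the least cardinal $\tau$ such that there is an ideal $J$ on $\kappa$ with $\mathrm{cof}(J)=\tau$ that is not weakly selective. For $A\subseteq P_\kappa(\lambda)$, $[A]^2_{\kappa,\kappa}=\{(\bigcup(a\cap\kappa),\bigcup(b\cap\kappa)):a,b\in A,\ \bigcup(a\cap\kappa)<\bigcup(b\cap\kappa)\}$. For $a,b\in P_\kappa(\lambda)$, $a\prec b$ means $a\subseteq b$ and $\bigcup(a\cap\kappa)<\bigcup(b\cap\kappa)$. For an ordinal $\alpha$, $H^+\xrightarrow[\kappa]{\kappa}(H^+,\alpha)^2$ means: for every $F:[P_\kappa(\lambda)]^2_{\kappa,\kappa}\to2$ and every $A\in H^+$ there is $B\subseteq A$ such that either $B\in H^+$ and $F$ is identically $0$ on $[B]^2_{\kappa,\kappa}$, or $(B,\prec)$ has order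 type $\alpha$ and $F$ is identically $1$ on $[B]^2_{\kappa,\kappa}$. -}

module Defs where

open import Data.Bool.Base using (Bool; true; T; _∧_; _∨_)
open import Data.Fin.Base using (Fin)
open import Data.Fin.Patterns using (0F; 1F)
open import Data.Nat.Base using (ℕ)
open import Data.Irrelevant using ([_])
open import Data.Product.Base using (Σ; ∃; ∃-syntax; _×_; _,_)
open import Data.Refinement.Base using (Refinement-syntax; value; _,_)
open import Data.Sum.Base using (_⊎_)
open import Function.Base using (_∘_; _on_)
open import Function.Bundles using (_↣_; _↔_)
open import Induction.WellFounded using (Acc; acc; WellFounded)
open import Level using (Level; suc; _⊔_; 0ℓ)
open import Relation.Binary.Core using (Rel)
open import Relation.Binary.Construct.Add.Supremum.Strict
  using (_<⁺_; [_]; [_]<⊤⁺; <⁺-isStrictTotalOrder-≡)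
open import Relation.Binary.Morphism.Structures using (IsOrderIsomorphism)
open import Relation.Binary.PropositionalEquality.Core using (_≡_)
open import Relation.Binary.Structures using (IsStrictTotalOrder)
open import Relation.Nullary.Construct.Add.Supremum using (_⁺; ⊤⁺; [_])
open import Relation.Nullary.Negation.Core using (¬_)
open import Relation.Unary using (Pred; _∈_; _∉_; _⊆_; _≐_; ｛_｝)

private
  variable
    a b c r s u : Level

-- The development is meant to be read with excluded middle (for arbitrary
-- types, hence choice as well) and function extensionality assumed. Under
-- these, A → Bool is the full power set of A with extensional equality, so
-- that the same notion of cardinality applies to sets of subsets.

𝒫 : Set a → Set a
𝒫 A = A → Bool

⟪_⟫ : {A : Set a} → 𝒫 A → Pred A 0ℓ
⟪ X ⟫ x = T (X x)

full : {A : Set a} → 𝒫 A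
full _ = true

_∩_ _∪_ : {A : Set a} → 𝒫 A → 𝒫 A → 𝒫 A
(X ∩ Y) x = X x ∧ Y x
(X ∪ Y) x = X x ∨ Y x

⋃ : {A : Set a} → 𝒫 (𝒫 A) → Pred A a
⋃ X x = ∃[ Y ] (Y ∈ ⟪ X ⟫ × x ∈ ⟪ Y ⟫)

-- Membership proofs in a subset type are irrelevant, so a subset type has
-- exactly one inhabitant for each member.

El : {A : Set a} → 𝒫 A → Set a
El {A = A} X = [ x ∈ A ∣ x ∈ ⟪ X ⟫ ]

infix 4 _≤ᶜ_ _<ᶜ_

_≤ᶜ_ : Set a → Set b → Set (a ⊔ b)
A ≤ᶜ B = A ↣ B

_<ᶜ_ : Set a → Set b → Set (a ⊔ b)
A <ᶜ B = A ≤ᶜ B × ¬ (B ≤ᶜ A)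

-- An ordinal is represented by a well-ordered type of that order type.

record Ordinal (u : Level) : Set (suc u) where
  field
    Carrier            : Set u
    _<_                : Rel Carrier u
    isStrictTotalOrder : IsStrictTotalOrder _≡_ _<_
    wellFounded        : WellFounded _<_

  ↓ : Carrier → Set u
  ↓ x = [ y ∈ Carrier ∣ y < x ]

∣_∣ : Ordinal u → Set u
∣_∣ = Ordinal.Carrier

OrderIso : {A : Set a} {B : Set b} → Rel A r → Rel B s → Set (a ⊔ b ⊔ r ⊔ s)
OrderIso _<₁_ _<₂_ = ∃ (IsOrderIsomorphism _≡_ _≡_ _<₁_ _<₂_)

HasOrderType : {A : Set a} → 𝒫 A → Rel A r → Ordinal u → Set (a ⊔ r ⊔ u)
HasOrderType X R α = OrderIso {A = El X} (R on value) (Ordinal._<_ α)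

_<ₒ_ : Ordinal u → Ordinal u → Set u
α <ₒ β = ∃[ b ] OrderIso {B = ↓ β b} (_<_ α) (_<_ β on value)
  where open Ordinal

-- α <ₒ β determines a unique embedding of α onto an initial segment of β;
-- it plays the role of the inclusion α ⊆ β between von Neumann ordinals.

embed : (α β : Ordinal u) → α <ₒ β → ∣ α ∣ → ∣ β ∣
embed α β (_ , f , _) = value ∘ f

_+1 : Ordinal u → Ordinal u
α +1 = record
  { Carrier            = Carrier ⁺
  ; _<_                = _<⁺_ _<_
  ; isStrictTotalOrder = <⁺-isStrictTotalOrder-≡ _<_ isStrictTotalOrder
  ; wellFounded        = λ where
      ⊤⁺    → acc λ { [ k ]<⊤⁺ → below (wellFounded k) }
      [ k ] → below (wellFounded k)
  }
  where
  open Ordinal α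
  below : ∀ {k} → Acc _<_ k → Acc (_<⁺_ _<_) [ k ]
  below (acc rs) = acc λ { [ j<k ] → below (rs j<k) }

-- Cardinals are initial ordinals.

IsCardinal : Ordinal u → Set u
IsCardinal κ = ∀ x → Ordinal.↓ κ x <ᶜ ∣ κ ∣

IsInfiniteCardinal : Ordinal u → Set u
IsInfiniteCardinal κ = IsCardinal κ × ℕ ≤ᶜ ∣ κ ∣

-- For an initial ordinal, being regular (cf κ = κ) says that no cofinal
-- subset has smaller cardinality.

IsRegularUncountableCardinal : Ordinal u → Set u
IsRegularUncountableCardinal κ =
  IsCardinal κ × ℕ <ᶜ ∣ κ ∣ × (∀ X → Cofinal X → ∣ κ ∣ ≤ᶜ El X)
  where
  open Ordinal κ using (_<_)
  Cofinal : 𝒫 ∣ κ ∣ → Set _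
  Cofinal X = ∀ ξ → ∃[ η ] (η ∈ ⟪ X ⟫ × ¬ (η < ξ))

record IsIdeal {S : Set a} (K : 𝒫 (𝒫 S)) : Set a where
  field
    singletons : ∀ x {A} → ⟪ A ⟫ ≐ ｛ x ｝ → A ∈ ⟪ K ⟫
    downward   : ∀ {A B} → ⟪ A ⟫ ⊆ ⟪ B ⟫ → B ∈ ⟪ K ⟫ → A ∈ ⟪ K ⟫
    union      : ∀ {A B} → A ∈ ⟪ K ⟫ → B ∈ ⟪ K ⟫ → (A ∪ B) ∈ ⟪ K ⟫
    proper     : full ∉ ⟪ K ⟫

record IsCompleteIdeal (κ : Ordinal u) {S : Set a} (K : 𝒫 (𝒫 S)) : Set (u ⊔ a) where
  field
    isIdeal  : IsIdeal K
    complete : ∀ X → ⟪ X ⟫ ⊆ ⟪ K ⟫ → El X <ᶜ ∣ κ ∣ →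
               ∀ {A} → ⟪ A ⟫ ≐ ⋃ X → A ∈ ⟪ K ⟫

module _ {S : Set a} where

  infix 4 _∈_⁺ᴵ
  infix 7 _↾_

  _∈_⁺ᴵ : 𝒫 S → 𝒫 (𝒫 S) → Set
  A ∈ K ⁺ᴵ = A ∉ ⟪ K ⟫

  _↾_ : 𝒫 (𝒫 S) → 𝒫 S → 𝒫 (𝒫 S)
  (K ↾ A) B = K (B ∩ A)

  Generates : 𝒫 (𝒫 S) → 𝒫 (𝒫 S) → Set a
  Generates X K =
    ⟪ X ⟫ ⊆ ⟪ K ⟫ × ⟪ K ⟫ ≐ (λ B → ∃[ A ] (A ∈ ⟪ X ⟫ × ⟪ B ⟫ ⊆ ⟪ A ⟫))

  -- cof(K) is the cardinality of the type μ. (In cardinal arithmetic, a type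
  -- stands for its cardinality.)

  IsCof : 𝒫 (𝒫 S) → Set b → Set (a ⊔ b)
  IsCof K μ = (∃[ X ] (Generates X K × (El X ↔ μ)))
            × (∀ X → Generates X K → μ ≤ᶜ El X)

Colouring : (A : Set a) → Pred (A × A) r → Set (a ⊔ r)
Colouring A D = [ p ∈ A × A ∣ p ∈ D ] → Fin 2

Constant : {A : Set a} {D : Pred (A × A) r} →
           Colouring A D → Pred (A × A) s → Fin 2 → Set (a ⊔ r ⊔ s)
Constant F E i = ∀ p → value p ∈ E → F p ≡ i

module OnCardinal (κ : Ordinal u) where
  open Ordinal κ using (_<_) renaming (Carrier to K)

  [_]² : 𝒫 K → Pred (K × K) u
  [ A ]² (ξ , η) = ξ ∈ ⟪ A ⟫ × η ∈ ⟪ A ⟫ × ξ < η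

  -- κ → (κ , α)²

  Arrow : Ordinal u → Set u
  Arrow α = (f : Colouring K [ full ]²) →
    ∃[ A ] ( (HasOrderType A _<_ κ × Constant f [ A ]² 0F)
           ⊎ (HasOrderType A _<_ α × Constant f [ A ]² 1F) )

  Fibre : (A : 𝒫 K) → (El A → K) → K → Pred K u
  Fibre A f α ξ = Σ (ξ ∈ ⟪ A ⟫) λ ξ∈A → f (ξ , [ ξ∈A ]) ≡ α

  WeakPPoint : 𝒫 (𝒫 K) → Set u
  WeakPPoint J = ∀ A (f : El A → K) → A ∈ J ⁺ᴵ →
    (∀ α {Z} → ⟪ Z ⟫ ≐ Fibre A f α → Z ∈ ⟪ J ⟫) →
    ∃[ B ] ( B ∈ J ⁺ᴵ × ⟪ B ⟫ ⊆ ⟪ A ⟫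
           × (∀ α → [ ξ ∈ K ∣ (ξ ∈ ⟪ B ⟫ × ξ ∈ Fibre A f α) ] <ᶜ K) )

  LocalQPoint : 𝒫 (𝒫 K) → Set u
  LocalQPoint J = (g : K → K) →
    ∃[ B ] (B ∈ J ⁺ᴵ × (∀ α β → (α , β) ∈ [ B ]² → g α < β))

  WeakQPoint : 𝒫 (𝒫 K) → Set u
  WeakQPoint J = ∀ A → A ∈ J ⁺ᴵ → LocalQPoint (J ↾ A)

  WeaklySelective : 𝒫 (𝒫 K) → Set u
  WeaklySelective J = WeakPPoint J × WeakQPoint J

  -- non_κ(weakly selective) is the cardinality of the type τ.

  IsNonWeaklySelective : Set u → Set (suc u)
  IsNonWeaklySelective τ = Witness τ × (∀ τ′ → Witness τ′ → τ ≤ᶜ τ′)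
    where
    Witness : Set u → Set u
    Witness σ = ∃[ J ] (IsCompleteIdeal κ J × IsCof J σ × ¬ WeaklySelective J)

module OnPκλ (κ Λ : Ordinal u) (κ<Λ : κ <ₒ Λ) where
  open Ordinal κ using (_<_) renaming (Carrier to K)
  open Ordinal Λ using () renaming (Carrier to L)

  Pκλ : Set u
  Pκλ = [ a ∈ 𝒫 L ∣ El a <ᶜ K ]

  infix 4 _⊑_ _≺_

  _⊑_ : Rel Pκλ u
  a ⊑ b = ⟪ value a ⟫ ⊆ ⟪ value b ⟫

  _∩κ : Pκλ → 𝒫 K
  a ∩κ = value a ∘ embed κ Λ κ<Λ

  -- σ = ⋃(a ∩ κ), where an ordinal is identified with the set of its
  -- predecessors.

  Is⋃∩κ : Pκλ → K → Set u
  Is⋃∩κ a σ = (_< σ) ≐ (λ ξ → ∃[ η ] (η ∈ ⟪ a ∩κ ⟫ × ξ < η))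

  _≺_ : Rel Pκλ u
  a ≺ b = a ⊑ b × ∃[ σ ] ∃[ τ ] (Is⋃∩κ a σ × Is⋃∩κ b τ × σ < τ)

  [_]²κκ : 𝒫 Pκλ → Pred (K × K) u
  [ A ]²κκ (σ , τ) = ∃[ a ] ∃[ b ]
    (a ∈ ⟪ A ⟫ × b ∈ ⟪ A ⟫ × Is⋃∩κ a σ × Is⋃∩κ b τ × σ < τ)

  Iκλ : Pred (𝒫 Pκλ) u
  Iκλ A = ∃[ a ] (∀ b → b ∈ ⟪ A ⟫ → ¬ (a ⊑ b))

  IsFineCompleteIdeal : 𝒫 (𝒫 Pκλ) → Set u
  IsFineCompleteIdeal H = IsCompleteIdeal κ H × Iκλ ⊆ ⟪ H ⟫

  -- H⁺ → (H⁺ , α)², with κ both above and below the arrow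

  Arrowκκ : 𝒫 (𝒫 Pκλ) → Ordinal u → Set u
  Arrowκκ H α = (F : Colouring K [ full ]²κκ) → ∀ A → A ∈ H ⁺ᴵ →
    ∃[ B ] ( ⟪ B ⟫ ⊆ ⟪ A ⟫
           × ( (B ∈ H ⁺ᴵ × Constant F [ B ]²κκ 0F)
             ⊎ (HasOrderType B _≺_ α × Constant F [ B ]²κκ 1F) ) )

{-# OPTIONS --safe #-}

-- Write σ(a) for ⋃(a ∩ κ) and fix A ∈ H⁺ without a subset in H⁺ that is homogeneous
-- of colour 0. For B ∈ H⁺ below A and γ < κ let Free B γ be the set of a ∈ B such that
-- σ(a) has colour 0 with every smaller σ(b) < γ, b ∈ B. Some Free B γ is in H: otherwise
-- these sets and H induce, via σ, a κ-complete ideal J on κ with cof(J) ≤ cof(H). So J is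
-- weakly selective, and since for each α ∈ σ[B] the set of β of colour 1 with α is in J,
-- there is a J-positive homogeneous set of colour 0, which pulls back to an H-positive one.
--
-- Hence almost every a ∈ B has colour 1 with one of fewer than κ canonical members of B,
-- and almost every a includes all of these. Choosing for each a ∈ A the first such member
-- and restricting B to the points with the same choices so far gives a tree of sequences,
-- in which almost every a survives θ steps as long as each level η < θ has fewer than κ
-- nodes; the chosen members, followed by a, form the required chain of type θ + 1.
--
-- The levels are small because κ → (κ, θ)² implies that κ does not inject into ^η γ for
-- η < θ and γ < κ: colour a pair of elements of ^η γ according to whether the
-- lexicographic order agrees with the order of κ. There is no lexicographically increasing
-- sequence of type κ, nor, for infinite η, a decreasing one of length |η|⁺ ≤ θ, as
-- the coordinates of such a sequence stabilise one after the other.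

module Submission where

open import Defs
open import Level using (Level)
open import Axiom.ExcludedMiddle using (ExcludedMiddle)
open import Axiom.Extensionality.Propositional using (Extensionality)

open import Data.Bool.Base using (T)
open import Data.Bool.Properties using (T-∧; T-∨)
open import Data.Empty using (⊥; ⊥-elim)
open import Data.Fin.Base using (Fin)
open import Data.Fin.Patterns using (0F; 1F)
open import Data.Irrelevant using (Irrelevant; [_])
open import Data.Maybe.Base as Maybe using (Maybe; just; nothing; fromMaybe)
open import Data.Maybe.Properties using (just-injective)
open import Data.Nat.Base using (ℕ; zero; suc; _<′_; <′-base; ≤′-step) renaming (_<_ to _<ℕ_)
open import Data.Nat.Induction using () renaming (<-wellFounded to <ℕ-wellFounded)
open import Data.Nat.Properties using (suc-injective; <-cmp; <⇒<′)
open import Data.Product.Base using (∃; ∃-syntax; _×_; _,_; proj₁; proj₂)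
open import Data.Product.Relation.Binary.Lex.Strict using (×-Lex; ×-wellFounded)
open import Data.Refinement.Base using (Refinement-syntax; value; _,_)
open import Data.Refinement.Properties using (value-injective)
open import Data.Sum.Base as Sum using (_⊎_; inj₁; inj₂)
open import Data.Unit.Base using (⊤; tt)
open import Function.Base using (_∘_; id; _on_)
open import Function.Bundles using (mk↣; module Injection; Equivalence)
open import Function.Construct.Composition using (injection)
open import Function.Construct.Identity using (↣-id; ↔-id)
open import Function.Properties.Inverse using (↔⇒↣)
open import Induction.WellFounded using (Acc; acc; WellFounded; WfRec; module All; module FixPoint)
import Relation.Binary.Construct.Add.Supremum.Strict as Strict
import Relation.Binary.Construct.On as On
open import Relation.Binary.Core using (Rel)
open import Relation.Binary.Definitions using (Tri; tri<; tri≈; tri>)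
open import Relation.Binary.Morphism.Structures using (IsOrderIsomorphism)
open import Relation.Binary.PropositionalEquality.Core
  using (_≡_; _≢_; refl; sym; trans; cong; cong₂; subst; subst₂)
open import Relation.Binary.Structures using (IsStrictTotalOrder)
open import Relation.Nullary.Construct.Add.Supremum as Sup using (⊤⁺)
open import Relation.Nullary.Decidable.Core
  using (Dec; yes; no; ⌊_⌋; toWitness; fromWitness; decidable-stable; recompute)
open import Relation.Nullary.Negation.Core using (¬_; contradiction)
open import Relation.Unary using (Pred; _∈_; _∉_; _⊆_; _≐_)

private
  variable
    a b c ℓ ℓ′ u : Level
    A : Set a
    B : Set b
    C : Set c
    D : Set ℓ′

-- Comparing cardinalities

mk≤ᶜ : (f : A → B) → (∀ {x y} → f x ≡ f y → x ≡ y) → A ≤ᶜ B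
mk≤ᶜ f inj = mk↣ {to = f} inj

≤ᶜ-trans : A ≤ᶜ B → B ≤ᶜ C → A ≤ᶜ C
≤ᶜ-trans = injection

≤ᶜ-injective : (f : A ≤ᶜ B) {x y : A} → Injection.to f x ≡ Injection.to f y → x ≡ y
≤ᶜ-injective f = Injection.injective f

onto⇒≥ᶜ : (h : A → B) → (∀ y → ∃[ x ] h x ≡ y) → B ≤ᶜ A
onto⇒≥ᶜ h onto = mk≤ᶜ (proj₁ ∘ onto) λ {x} {y} eq →
  trans (sym (proj₂ (onto x))) (trans (cong h eq) (proj₂ (onto y)))

shade : Dec A → Fin 2
shade (yes _) = 1F
shade (no _)  = 0F

shade≡1 : (A? : Dec A) → shade A? ≡ 1F → A
shade≡1 (yes x) _ = x

shade≡0 : (A? : Dec A) → shade A? ≡ 0F → ¬ A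
shade≡0 (no ¬x) _ = ¬x

module WellOrder (O : Ordinal u) where
  open Ordinal O public using (Carrier; _<_; isStrictTotalOrder; wellFounded; ↓)
  open IsStrictTotalOrder isStrictTotalOrder public
    using (compare) renaming (trans to <-trans)

  <-irrefl : ∀ {x} → ¬ (x < x)
  <-irrefl = IsStrictTotalOrder.irrefl isStrictTotalOrder refl

  <-asym : ∀ {x y} → x < y → ¬ (y < x)
  <-asym p q = <-irrefl (<-trans p q)

  ≮⇒≡⊎> : ∀ {x y} → ¬ (x < y) → x ≡ y ⊎ y < x
  ≮⇒≡⊎> {x} {y} x≮y with compare x y
  ... | tri< x<y _ _ = contradiction x<y x≮y
  ... | tri≈ _ x≡y _ = inj₁ x≡y
  ... | tri> _ _ y<x = inj₂ y<x

  ≮-<-trans : ∀ {x y z} → ¬ (y < x) → y < z → x < z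
  ≮-<-trans y≮x y<z with ≮⇒≡⊎> y≮x
  ... | inj₁ refl = y<z
  ... | inj₂ x<y = <-trans x<y y<z

  <-≮-trans : ∀ {x y z} → x < y → ¬ (z < y) → x < z
  <-≮-trans x<y z≮y with ≮⇒≡⊎> z≮y
  ... | inj₁ refl = x<y
  ... | inj₂ y<z = <-trans x<y y<z

-- Classical reasoning and power sets

module Classical
  (em : ∀ {ℓ} → ExcludedMiddle ℓ)
  (ext : ∀ {ℓ₁ ℓ₂} → Extensionality ℓ₁ ℓ₂)
  where

  abstract
    byContradiction : ¬ ¬ A → A
    byContradiction = decidable-stable em

  unsquash : .A → A
  unsquash = recompute em

  ¬∀⇒∃¬ : {P : A → Set ℓ} → ¬ (∀ x → P x) → ∃[ x ] ¬ P x
  ¬∀⇒∃¬ ¬∀ = byContradiction λ ¬∃ → ¬∀ λ x → byContradiction λ ¬p → ¬∃ (x , ¬p)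

  char : Pred A ℓ → 𝒫 A
  char P x = ⌊ em {P = P x} ⌋

  char⁺ : (P : Pred A ℓ) → P ⊆ ⟪ char P ⟫
  char⁺ P p = fromWitness p

  char⁻ : (P : Pred A ℓ) → ⟪ char P ⟫ ⊆ P
  char⁻ P p = toWitness p

  𝒫-ext : {X Y : 𝒫 A} → ⟪ X ⟫ ≐ ⟪ Y ⟫ → X ≡ Y
  𝒫-ext {X = X} {Y} (X⊆Y , Y⊆X) = ext λ x → bool (X x) (Y x) X⊆Y Y⊆X
    where
    open import Data.Bool.Base using (Bool; true; false)
    bool : (p q : Bool) → (T p → T q) → (T q → T p) → p ≡ q
    bool true  true  _ _ = refl
    bool true  false f _ = ⊥-elim (f tt)
    bool false true  _ g = ⊥-elim (g tt)
    bool false false _ _ = refl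

  prf : {P : Pred A ℓ} (e : [ x ∈ A ∣ P x ]) → P (value e)
  prf (_ , [ p ]) = unsquash p

  Image : (B → A) → Pred A _
  Image f x = ∃[ y ] f y ≡ x

  image : (B → A) → 𝒫 A
  image f = char (Image f)

  image≤ᶜ : (f : B → A) → El (image f) ≤ᶜ B
  image≤ᶜ f = onto⇒≥ᶜ (λ y → f y , [ char⁺ (Image f) (y , refl) ]) λ e →
    let y , eq = char⁻ (Image f) (prf e) in y , value-injective eq

  -- Towers of an inflationary operation

  module _ {a} {A : Set a}
    (step : 𝒫 A → 𝒫 A) (inflationary : ∀ X → ⟪ X ⟫ ⊆ ⟪ step X ⟫)
    where

    -- Zermelo's towers, in place of Zorn's lemma: the least family closed under `step` and unions
    -- is a chain, so its own union is a fixed point of `step`.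
    data Tower : 𝒫 A → Set a where
      successor : ∀ {X} → Tower X → Tower (step X)
      limit     : ∀ 𝒴 → (∀ X → X ∈ ⟪ 𝒴 ⟫ → Tower X) → Tower (char (⋃ 𝒴))

    private
      -- Stronger than comparability: nothing lies strictly between `Y` and `step Y`. The successor
      -- case of the induction needs this.
      _◁_ : 𝒫 A → 𝒫 A → Set a
      X ◁ Y = ⟪ X ⟫ ⊆ ⟪ Y ⟫ ⊎ ⟪ step Y ⟫ ⊆ ⟪ X ⟫

      next-◁ : ∀ {X Y} → X ◁ Y → Y ◁ X → step X ◁ Y
      next-◁ {X} (inj₂ sY⊆X) _ = inj₂ λ y → inflationary X (sY⊆X y)
      next-◁ (inj₁ X⊆Y) (inj₂ sX⊆Y) = inj₁ sX⊆Y
      next-◁ {X} {Y} (inj₁ X⊆Y) (inj₁ Y⊆X)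
        with refl ← 𝒫-ext {X = X} {Y} (X⊆Y , Y⊆X) = inj₂ λ x → x

      union-◁ : ∀ 𝒴 {Y} → (∀ X → X ∈ ⟪ 𝒴 ⟫ → X ◁ Y) → char (⋃ 𝒴) ◁ Y
      union-◁ 𝒴 {Y} h with em {P = ∃[ X ] (X ∈ ⟪ 𝒴 ⟫ × ⟪ step Y ⟫ ⊆ ⟪ X ⟫)}
      ... | yes (X , X∈𝒴 , sY⊆X) = inj₂ λ y → char⁺ (⋃ 𝒴) (X , X∈𝒴 , sY⊆X y)
      ... | no ¬above = inj₁ λ x∈⋃ → below (char⁻ (⋃ 𝒴) x∈⋃)
        where
        below : ∀ {x} → x ∈ ⋃ 𝒴 → x ∈ ⟪ Y ⟫
        below (X , X∈𝒴 , x∈X) with h X X∈𝒴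
        ... | inj₁ X⊆Y  = X⊆Y x∈X
        ... | inj₂ sY⊆X = ⊥-elim (¬above (X , X∈𝒴 , sY⊆X))

      -- `◁` is not symmetric and `next-◁` consumes both directions, so linearity takes two nested
      -- inductions; this is the inner one.
      flip-◁ : ∀ {X Y} → (∀ {Z} → Tower Z → X ◁ Z) → Tower X → Tower Y → Y ◁ X
      flip-◁ h tX (successor tY)   = next-◁ (flip-◁ h tX tY) (h tY)
      flip-◁ h tX (limit 𝒴 t) = union-◁ 𝒴 λ Z Z∈𝒴 → flip-◁ h tX (t Z Z∈𝒴)

      Tower-◁ : ∀ {X Y} → Tower X → Tower Y → X ◁ Y
      Tower-◁ (successor tX)   tY = next-◁ (Tower-◁ tX tY) (flip-◁ (Tower-◁ tX) tX tY)
      Tower-◁ (limit 𝒴 t) tY = union-◁ 𝒴 λ Z Z∈𝒴 → Tower-◁ (t Z Z∈𝒴) tY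

    Tower-linear : ∀ {X Y} → Tower X → Tower Y → ⟪ X ⟫ ⊆ ⟪ Y ⟫ ⊎ ⟪ Y ⟫ ⊆ ⟪ X ⟫
    Tower-linear {X} {Y} tX tY with Tower-◁ tX tY
    ... | inj₁ X⊆Y  = inj₁ X⊆Y
    ... | inj₂ sY⊆X = inj₂ λ y → sY⊆X (inflationary Y y)

    top : 𝒫 A
    top = char (⋃ (char Tower))

    Tower-top : Tower top
    Tower-top = limit (char Tower) λ X → char⁻ Tower

    step-top : ⟪ step top ⟫ ⊆ ⟪ top ⟫
    step-top x = char⁺ (⋃ (char Tower)) (step top , char⁺ Tower (successor Tower-top) , x)

  -- A member of least cardinality in a family

  module _ {a} {I : Set a} (S : I → Set a) where
    private
      Π = ∀ i → S i

      Fresh : 𝒫 Π → Pred Π a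
      Fresh X p = ∀ i q → q ∈ ⟪ X ⟫ → q i ≢ p i

      Separated : 𝒫 Π → Set a
      Separated X = ∀ i {p q} → p ∈ ⟪ X ⟫ → q ∈ ⟪ X ⟫ → p i ≡ q i → p ≡ q

      Extended : 𝒫 Π → Π → Pred Π a
      Extended X p q = q ∈ ⟪ X ⟫ ⊎ q ≡ p

      step : 𝒫 Π → 𝒫 Π
      step X with em {P = ∃ (Fresh X)}
      ... | yes (p , _) = char (Extended X p)
      ... | no _        = X

      inflationary : ∀ X → ⟪ X ⟫ ⊆ ⟪ step X ⟫
      inflationary X x∈X with em {P = ∃ (Fresh X)}
      ... | yes (p , _) = char⁺ (Extended X p) (inj₁ x∈X)
      ... | no _        = x∈X

      step-adds : ∀ X → ∃ (Fresh X) → ∃[ p ] (Fresh X p × p ∈ ⟪ step X ⟫)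
      step-adds X fresh with em {P = ∃ (Fresh X)}
      ... | yes (p , f) = p , f , char⁺ (Extended X p) (inj₂ refl)
      ... | no ¬fresh   = ⊥-elim (¬fresh fresh)

      step-separated : ∀ X → Separated X → Separated (step X)
      step-separated X sep with em {P = ∃ (Fresh X)}
      ... | no _        = sep
      ... | yes (p , f) = λ i p∈ q∈ → ext-sep i (char⁻ (Extended X p) p∈) (char⁻ (Extended X p) q∈)
        where
        ext-sep : ∀ i {r s} → Extended X p r → Extended X p s → r i ≡ s i → r ≡ s
        ext-sep i (inj₁ r)    (inj₁ s)    eq = sep i r s eq
        ext-sep i (inj₁ r)    (inj₂ refl) eq = ⊥-elim (f i _ r eq)
        ext-sep i (inj₂ refl) (inj₁ s)    eq = ⊥-elim (f i _ s (sym eq))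
        ext-sep i (inj₂ refl) (inj₂ refl) eq = refl

      Tower-separated : ∀ {X} → Tower step inflationary X → Separated X
      Tower-separated (successor t) = step-separated _ (Tower-separated t)
      Tower-separated (limit 𝒴 t) i p∈⋃ q∈⋃ eq =
        joint (char⁻ (⋃ 𝒴) p∈⋃) (char⁻ (⋃ 𝒴) q∈⋃)
        where
        joint : _ ∈ ⋃ 𝒴 → _ ∈ ⋃ 𝒴 → _
        joint (X , X∈𝒴 , p∈X) (Y , Y∈𝒴 , q∈Y)
          with Tower-linear step inflationary (t X X∈𝒴) (t Y Y∈𝒴)
        ... | inj₁ X⊆Y = Tower-separated (t Y Y∈𝒴) i (X⊆Y p∈X) q∈Y eq
        ... | inj₂ Y⊆X = Tower-separated (t X X∈𝒴) i p∈X (Y⊆X q∈Y) eq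

    -- A maximal set of points of the product all of whose projections are
    -- injective has a surjective projection.

    least-cardinality : I → ∃[ i ] ∀ j → S i ≤ᶜ S j
    least-cardinality i₀ = i , λ j → mk≤ᶜ (λ s → proj₁ (onto s) j) λ {s} {t} eq →
      trans (sym (proj₂ (proj₂ (onto s))))
        (trans (cong (λ p → p i) (separated j (proj₁ (proj₂ (onto s))) (proj₁ (proj₂ (onto t))) eq))
          (proj₂ (proj₂ (onto t))))
      where
      M = top step inflationary
      separated = Tower-separated (Tower-top step inflationary)
      ¬fresh : ¬ ∃ (Fresh M)
      ¬fresh fresh = let p , f , p∈ = step-adds M fresh in
        -- The added point already lies in `M`, which `step` fixes, so at the coordinate `i₀` it
        -- would have to differ from itself.
        f i₀ p (step-top step inflationary p∈) refl
      Onto : I → Set a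
      Onto i = ∀ s → ∃[ p ] (p ∈ ⟪ M ⟫ × p i ≡ s)
      some-onto : ∃ Onto
      some-onto = byContradiction λ ¬onto →
        let missed = λ i → ¬∀⇒∃¬ (λ h → ¬onto (i , h)) in
        ¬fresh (proj₁ ∘ missed , λ i q q∈M eq → proj₂ (missed i) (q , q∈M , eq))
      i = proj₁ some-onto
      onto = proj₂ some-onto

  -- Minimal elements and transfinite choice

  least : {_<_ : Rel A ℓ} → WellFounded _<_ → (P : Pred A c) → ∃ P →
          ∃[ x ] (P x × (∀ y → P y → ¬ (y < x)))
  least {_<_ = _<_} wf P (x₀ , p₀) = byContradiction λ ¬least →
    All.wfRec wf _ (λ x → ¬ P x)
      (λ x rec px → ¬least (x , px , λ y py y<x → rec y<x py)) x₀ p₀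

  Total : {A : Set a} → Rel A ℓ → Set _
  Total _<_ = ∀ x y → x ≡ y ⊎ (x < y ⊎ y < x)

  module _ {A : Set a} {B : Set b} {_≺_ : Rel A ℓ}
    (wf : WellFounded _≺_) (total : Total _≺_)
    where

    -- Transfinite recursion along `≺`. The history takes `v ≺ w` irrelevantly, so that it is a
    -- function on the subset type of predecessors of `w`; `≰ᶜ⇒≤ᶜsegment` uses it as such.
    greedy : (∀ w (h : ∀ v → .(v ≺ w) → B) → ∃[ s ] (∀ v (v≺w : v ≺ w) → h v v≺w ≢ s)) → A ≤ᶜ B
    greedy fresh = mk≤ᶜ g injective
      where
      irr-ext : ∀ {P : Set ℓ} {f g : .P → B} → (∀ .p → f p ≡ g p) → (λ .p → f p) ≡ g
      irr-ext {P} {f} {g} eq = cong (λ (h : Irrelevant P → B) .p → h [ p ])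
        (ext {f = λ { [ p ] → f p }} {g = λ { [ p ] → g p }} λ { [ p ] → eq p })
      step : ∀ w → WfRec _≺_ (λ _ → B) w → B
      step w rec = proj₁ (fresh w λ v v≺w → rec (unsquash v≺w))
      step-ext : ∀ w {rec rec′ : WfRec _≺_ (λ _ → B) w} →
                 (∀ {v} v≺w → rec {v} v≺w ≡ rec′ v≺w) → step w rec ≡ step w rec′
      step-ext w eq = cong (λ h → proj₁ (fresh w h)) (ext λ v → irr-ext λ v≺w → eq (unsquash v≺w))
      open FixPoint wf (λ _ → B) step step-ext using (unfold-wfRec)
      g : A → B
      g = All.wfRec wf _ (λ _ → B) step
      g-fresh : ∀ v w → v ≺ w → g v ≢ g w
      g-fresh v w v≺w eq =
        proj₂ (fresh w λ v _ → g v) v v≺w (trans eq unfold-wfRec)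
      injective : ∀ {v w} → g v ≡ g w → v ≡ w
      injective {v} {w} eq with total v w
      ... | inj₁ v≡w        = v≡w
      ... | inj₂ (inj₁ v≺w) = ⊥-elim (g-fresh v w v≺w eq)
      ... | inj₂ (inj₂ w≺v) = ⊥-elim (g-fresh w v w≺v (sym eq))

    -- Greedy choice can fail only at a `w` before which all of `B` has been used up; the
    -- predecessors of `w` then map onto `B`.
    ≰ᶜ⇒≤ᶜsegment : ¬ (A ≤ᶜ B) → ∃[ w ] (B ≤ᶜ [ v ∈ A ∣ v ≺ w ])
    ≰ᶜ⇒≤ᶜsegment A≰B = byContradiction λ ¬seg → A≰B (greedy λ w h →
      byContradiction λ ¬fresh → ¬seg (w , onto⇒≥ᶜ
        (λ v → h (value v) (prf v))
        λ s → byContradiction λ ¬hit → ¬fresh (s , λ v v≺w eq →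
          ¬hit ((v , [ v≺w ]) , eq))))

  -- Pairing functions and initial segments of ordinals

  private
    double : ℕ → ℕ
    double zero    = zero
    double (suc n) = suc (suc (double n))

    double-injective : ∀ m n → double m ≡ double n → m ≡ n
    double-injective zero    zero    _  = refl
    double-injective (suc m) (suc n) eq =
      cong suc (double-injective m n (suc-injective (suc-injective eq)))

    odd≢even : ∀ m n → suc (double m) ≢ double n
    odd≢even (suc m) (suc n) eq = odd≢even m n (suc-injective (suc-injective eq))

    -- The code of (m, n) is 2^m (2n + 1).
    pair : ℕ × ℕ → ℕ
    pair (zero  , n) = suc (double n)
    pair (suc m , n) = double (pair (m , n))

    pair-injective : ∀ p q → pair p ≡ pair q → p ≡ q
    pair-injective (zero , n) (zero , n′) eq = cong (zero ,_) (double-injective n n′ (suc-injective eq))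
    pair-injective (zero , n) (suc m′ , n′) eq = ⊥-elim (odd≢even n _ eq)
    pair-injective (suc m , n) (zero , n′) eq = ⊥-elim (odd≢even n′ _ (sym eq))
    pair-injective (suc m , n) (suc m′ , n′) eq
      with refl ← pair-injective (m , n) (m′ , n′) (double-injective _ _ eq) = refl

  ℕ×ℕ≤ᶜℕ : (ℕ × ℕ) ≤ᶜ ℕ
  ℕ×ℕ≤ᶜℕ = mk≤ᶜ pair λ {p} {q} → pair-injective p q

  ×-≤ᶜ : A ≤ᶜ B → C ≤ᶜ D → (A × C) ≤ᶜ (B × D)
  ×-≤ᶜ f g = mk≤ᶜ (λ (x , y) → Injection.to f x , Injection.to g y) λ eq →
    cong₂ _,_ (≤ᶜ-injective f (cong proj₁ eq)) (≤ᶜ-injective g (cong proj₂ eq))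

  Maybe-≤ᶜ : A ≤ᶜ B → Maybe A ≤ᶜ Maybe B
  Maybe-≤ᶜ f = mk≤ᶜ (Maybe.map (Injection.to f))
    λ { {just _} {just _} eq → cong just (≤ᶜ-injective f (just-injective eq))
      ; {nothing} {nothing} _ → refl }

  Maybe≤ᶜ : (A × A) ≤ᶜ A → ℕ ≤ᶜ A → Maybe A ≤ᶜ A
  Maybe≤ᶜ {A = A} A²≤A ℕ≤A = ≤ᶜ-trans (mk≤ᶜ tag tag-injective) A²≤A
    where
    x₀ x₁ : A
    x₀ = Injection.to ℕ≤A 0
    x₁ = Injection.to ℕ≤A 1
    x₀≢x₁ : x₀ ≢ x₁
    x₀≢x₁ eq with () ← ≤ᶜ-injective ℕ≤A eq
    tag : Maybe A → A × A
    tag (just x) = x₀ , x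
    tag nothing  = x₁ , x₀
    tag-injective : ∀ {x y} → tag x ≡ tag y → x ≡ y
    tag-injective {just x}  {just y}  eq = cong just (cong proj₂ eq)
    tag-injective {just x}  {nothing} eq = ⊥-elim (x₀≢x₁ (cong proj₁ eq))
    tag-injective {nothing} {just y}  eq = ⊥-elim (x₀≢x₁ (sym (cong proj₁ eq)))
    tag-injective {nothing} {nothing} eq = refl

  ×-total : {_<₁_ : Rel A ℓ} {_<₂_ : Rel B c} →
            Total _<₁_ → Total _<₂_ → Total (×-Lex _≡_ _<₁_ _<₂_)
  ×-total t₁ t₂ (x , y) (x′ , y′) with t₁ x x′ | t₂ y y′
  ... | inj₂ (inj₁ lt) | _              = inj₂ (inj₁ (inj₁ lt))
  ... | inj₂ (inj₂ gt) | _              = inj₂ (inj₂ (inj₁ gt))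
  ... | inj₁ refl      | inj₁ refl      = inj₁ refl
  ... | inj₁ refl      | inj₂ (inj₁ lt) = inj₂ (inj₁ (inj₂ (refl , lt)))
  ... | inj₁ refl      | inj₂ (inj₂ gt) = inj₂ (inj₂ (inj₂ (refl , gt)))

  ℕ-total : Total _<ℕ_
  ℕ-total m n with <-cmp m n
  ... | tri< lt _ _ = inj₂ (inj₁ lt)
  ... | tri≈ _ eq _ = inj₁ eq
  ... | tri> _ _ gt = inj₂ (inj₂ gt)

  module OrdinalCardinality (O : Ordinal u) where
    open WellOrder O

    <-total : Total _<_
    <-total x y with compare x y
    ... | tri< lt _ _ = inj₂ (inj₁ lt)
    ... | tri≈ _ eq _ = inj₁ eq
    ... | tri> _ _ gt = inj₂ (inj₂ gt)

    least-element : (P : Pred Carrier c) → ∃ P → ∃[ x ] (P x × (∀ y → P y → ¬ (y < x)))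
    least-element = least wellFounded

    ↓-mono : ∀ {x y} → x < y → ↓ x ≤ᶜ ↓ y
    ↓-mono x<y = mk≤ᶜ (λ z → value z , [ <-trans (prf z) x<y ])
      λ eq → value-injective (cong value eq)

    ↓-≤ᶜ : ∀ {x} → ↓ x ≤ᶜ Carrier
    ↓-≤ᶜ = mk≤ᶜ value value-injective

    private
      max : Carrier → Carrier → Carrier
      max x y with compare x y
      ... | tri< _ _ _ = y
      ... | tri≈ _ _ _ = x
      ... | tri> _ _ _ = x

      max-≮ : ∀ x y → ¬ (max x y < x) × ¬ (max x y < y)
      max-≮ x y with compare x y
      ... | tri< x<y _ _  = <-asym x<y , <-irrefl
      ... | tri≈ _ refl _ = <-irrefl , <-irrefl
      ... | tri> _ _ y<x  = <-irrefl , <-asym y<x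

      max-< : ∀ x y {z} → x < z → y < z → max x y < z
      max-< x y x<z y<z with compare x y
      ... | tri< _ _ _ = y<z
      ... | tri≈ _ _ _ = x<z
      ... | tri> _ _ _ = x<z

      Triple = Carrier × Carrier × Carrier

      _<₃_ : Rel Triple _
      _<₃_ = ×-Lex _≡_ _<_ (×-Lex _≡_ _<_ _<_)

      module _ {i : Carrier} where
        -- Gödel's well-ordering of pairs. Everything before a pair with maximum `m` lies in the
        -- square of the closed segment `↓⁼ m`.
        gödel : ↓ i × ↓ i → Triple
        gödel (x , y) = max (value x) (value y) , value x , value y

        _≺_ : Rel (↓ i × ↓ i) _
        _≺_ = _<₃_ on gödel

        ≺-wellFounded : WellFounded _≺_
        ≺-wellFounded = On.wellFounded gödel
          (×-wellFounded wellFounded (×-wellFounded wellFounded wellFounded))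

        ≺-total : Total _≺_
        ≺-total v w with ×-total <-total (×-total <-total <-total) (gödel v) (gödel w)
        ... | inj₁ eq = inj₁ (cong₂ _,_
          (value-injective (cong (proj₁ ∘ proj₂) eq)) (value-injective (cong (proj₂ ∘ proj₂) eq)))
        ... | inj₂ lt = inj₂ lt

      ↓⁼ : Carrier → Set _
      ↓⁼ m = [ x ∈ Carrier ∣ ¬ (m < x) ]

      ↓⁼-≤ᶜ : ∀ m → ↓⁼ m ≤ᶜ Maybe (↓ m)
      ↓⁼-≤ᶜ m = mk≤ᶜ (λ x → to x em) λ {x} {y} → to-injective x y em em
        where
        to : (x : ↓⁼ m) → Dec (value x < m) → Maybe (↓ m)
        to x (yes x<m) = just (value x , [ x<m ])
        to x (no _)    = nothing
        to-injective : ∀ x y d e → to x d ≡ to y e → x ≡ y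
        to-injective x y (yes _) (yes _) eq = value-injective (cong value (just-injective eq))
        to-injective x y (no x≮m) (no y≮m) _ = value-injective (trans (≡m x x≮m) (sym (≡m y y≮m)))
          where
          ≡m : (z : ↓⁼ m) → ¬ (value z < m) → value z ≡ m
          ≡m z z≮m with ≮⇒≡⊎> z≮m
          ... | inj₁ eq  = eq
          ... | inj₂ m<z = ⊥-elim (prf z m<z)

      segment-≤ᶜ : ∀ {i} (w : ↓ i × ↓ i) → let m = max (value (proj₁ w)) (value (proj₂ w)) in
                   [ v ∈ ↓ i × ↓ i ∣ v ≺ w ] ≤ᶜ (↓⁼ m × ↓⁼ m)
      segment-≤ᶜ w@(x , y) = mk≤ᶜ
        (λ v@((x′ , y′) , _) →
            (value x′ , [ (λ m<x → proj₁ (max-≮ (value x′) (value y′)) (max≤ {value v} (prf v) m<x)) ])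
          , (value y′ , [ (λ m<y → proj₂ (max-≮ (value x′) (value y′)) (max≤ {value v} (prf v) m<y)) ]))
        λ eq → value-injective (cong₂ _,_
          (value-injective (cong (λ p → value (proj₁ p)) eq)) (value-injective (cong (λ p → value (proj₂ p)) eq)))
        where
        max≤ : ∀ {v z} → v ≺ w → max (value x) (value y) < z → proj₁ (gödel v) < z
        max≤ (inj₁ lt)       m<z = <-trans lt m<z
        max≤ (inj₂ (eq , _)) m<z = subst (_< _) (sym eq) m<z

    -- Hessenberg's theorem. If `↓ i` embeds in an earlier segment or in `ℕ`, the pairing known
    -- there transfers. Otherwise a failure would embed `↓ i` in a segment of Gödel's order, hence
    -- in the square of some `↓⁼ m` with `m < i`; by induction this square embeds in `↓ m` or in
    -- `ℕ`.
    ↓-square : ∀ i → ℕ ≤ᶜ ↓ i → (↓ i × ↓ i) ≤ᶜ ↓ i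
    ↓-square i = go i (wellFounded i)
      where
      go : ∀ i → Acc _<_ i → ℕ ≤ᶜ ↓ i → (↓ i × ↓ i) ≤ᶜ ↓ i
      go i (acc rs) ℕ≤i with em {P = ∃[ j ] (j < i × ↓ i ≤ᶜ ↓ j)} | em {P = ↓ i ≤ᶜ ℕ}
      ... | yes (j , j<i , i≤j) | _ =
        ≤ᶜ-trans (×-≤ᶜ i≤j i≤j) (≤ᶜ-trans (go j (rs j<i) (≤ᶜ-trans ℕ≤i i≤j)) (↓-mono j<i))
      ... | no _ | yes i≤ℕ = ≤ᶜ-trans (×-≤ᶜ i≤ℕ i≤ℕ) (≤ᶜ-trans ℕ×ℕ≤ᶜℕ ℕ≤i)
      ... | no ¬smaller | no i≰ℕ = byContradiction λ i²≰i →
        let w , i≤seg = ≰ᶜ⇒≤ᶜsegment ≺-wellFounded ≺-total i²≰i in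
        bounded w (≤ᶜ-trans i≤seg (segment-≤ᶜ w))
        where
        bounded : (w : ↓ i × ↓ i) →
          let m = max (value (proj₁ w)) (value (proj₂ w)) in ¬ (↓ i ≤ᶜ (↓⁼ m × ↓⁼ m))
        bounded (x , y) i≤m² with em {P = ℕ ≤ᶜ ↓ m}
          where m = max (value x) (value y)
        ... | yes ℕ≤m = ¬smaller (m , m<i , ≤ᶜ-trans i≤m² (≤ᶜ-trans (×-≤ᶜ m⁼≤m m⁼≤m) m²≤m))
          where
          m = max (value x) (value y)
          m<i = max-< (value x) (value y) (prf x) (prf y)
          m²≤m = go m (rs m<i) ℕ≤m
          m⁼≤m = ≤ᶜ-trans (↓⁼-≤ᶜ m) (Maybe≤ᶜ m²≤m ℕ≤m)
        ... | no ℕ≰m = i≰ℕ (≤ᶜ-trans i≤m² (≤ᶜ-trans (×-≤ᶜ m⁼≤ℕ m⁼≤ℕ) ℕ×ℕ≤ᶜℕ))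
          where
          m = max (value x) (value y)
          m≤ℕ : ↓ m ≤ᶜ ℕ
          m≤ℕ = ≤ᶜ-trans (proj₂ (≰ᶜ⇒≤ᶜsegment <ℕ-wellFounded ℕ-total ℕ≰m)) (mk≤ᶜ value value-injective)
          m⁼≤ℕ = ≤ᶜ-trans (↓⁼-≤ᶜ m) (≤ᶜ-trans (Maybe-≤ᶜ m≤ℕ) (Maybe≤ᶜ ℕ×ℕ≤ᶜℕ (↣-id ℕ)))

    -- The ordinals of cardinality at most |η| form a successor cardinal, hence
    -- a regular one.

    |η|⁺-bounded : IsCardinal O → ∀ η → ℕ ≤ᶜ ↓ η →
                   (b : Carrier → Carrier) → (∀ δ → ↓ (b δ) ≤ᶜ ↓ η) →
                   ∃[ c ] (↓ c ≤ᶜ ↓ η × (∀ δ → δ < η → b δ < c))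
    |η|⁺-bounded cardinal η ℕ≤η b b≤η = byContradiction λ unbounded →
      let cov = covered unbounded in ¬H≤η (≤ᶜ-trans
        (mk≤ᶜ (code cov) λ {c} {d} → code-injective cov c d)
        (≤ᶜ-trans (×-≤ᶜ (↣-id _) (Maybe≤ᶜ (↓-square η ℕ≤η) ℕ≤η)) (↓-square η ℕ≤η)))
      where
      H : Set _
      H = [ c ∈ Carrier ∣ ↓ c ≤ᶜ ↓ η ]
      Covered : H → Set _
      Covered c = ∃[ δ ] (δ < η × ¬ (b δ < value c))
      covered : ¬ (∃[ c ] (↓ c ≤ᶜ ↓ η × (∀ δ → δ < η → b δ < c))) → ∀ c → Covered c
      covered unbounded c = byContradiction λ ¬covered →
        unbounded (value c , prf c , λ δ δ<η → byContradiction λ bδ≮c → ¬covered (δ , δ<η , bδ≮c))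
      rank : ∀ δ → ↓⁼ (b δ) ≤ᶜ Maybe (↓ η)
      rank δ = ≤ᶜ-trans (↓⁼-≤ᶜ (b δ)) (Maybe-≤ᶜ (b≤η δ))
      position : (cov : ∀ c → Covered c) (c : H) → ↓⁼ (b (proj₁ (cov c)))
      position cov c = value c , [ proj₂ (proj₂ (cov c)) ]
      -- If `b` were unbounded, `H` would be covered by the closed segments up to `b δ`: |η| many,
      -- each of size at most |η|. An element is coded by its segment and its position there.
      code : (∀ c → Covered c) → H → ↓ η × Maybe (↓ η)
      code cov c = (proj₁ (cov c) , [ proj₁ (proj₂ (cov c)) ])
                 , Injection.to (rank (proj₁ (cov c))) (position cov c)
      rank-injective : ∀ {δ ε} x y → δ ≡ ε →
        Injection.to (rank δ) x ≡ Injection.to (rank ε) y → value x ≡ value y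
      rank-injective {δ} x y refl eq = cong value (≤ᶜ-injective (rank δ) eq)
      code-injective : ∀ cov c d → code cov c ≡ code cov d → c ≡ d
      code-injective cov c d eq = value-injective
        (rank-injective (position cov c) (position cov d)
          (cong (λ p → value (proj₁ p)) eq) (cong proj₂ eq))
      ¬H≤η : ¬ (H ≤ᶜ ↓ η)
      -- `H` is all of the ordinal, which is a cardinal above `η`, or it includes the segment below
      -- the first `i` of cardinality greater than |η|.
      ¬H≤η H≤η with em {P = ∃[ i ] ¬ (↓ i ≤ᶜ ↓ η)}
      ... | no all = proj₂ (cardinal η) (≤ᶜ-trans
              (mk≤ᶜ (λ i → i , [ byContradiction (λ i≰η → all (i , i≰η)) ]) (cong value)) H≤η)
      ... | yes some with i , i≰η , lst ← least-element (λ i → ¬ (↓ i ≤ᶜ ↓ η)) some = i≰η (≤ᶜ-trans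
              (mk≤ᶜ (λ j → value j , [ byContradiction (λ j≰η → lst _ j≰η (prf j)) ])
                λ eq → value-injective (cong value eq)) H≤η)

  HasOrderType⇒enumeration : {X : 𝒫 A} {R : Rel A ℓ} (α : Ordinal u) → HasOrderType X R α →
    ∃[ ψ ] ((∀ i → ψ i ∈ ⟪ X ⟫) × (∀ i j → Ordinal._<_ α i j → R (ψ i) (ψ j)))
  HasOrderType⇒enumeration {X = X} {R} α (φ , iso) =
    (λ i → value (φ⁻¹ i)) , (λ i → prf (φ⁻¹ i)) , λ i j i<j →
      cancel (subst₂ (Ordinal._<_ α) (sym (φφ⁻¹ i)) (sym (φφ⁻¹ j)) i<j)
    where
    open IsOrderIsomorphism iso
    φ⁻¹ : ∣ α ∣ → El X
    φ⁻¹ i = proj₁ (surjective i)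
    φφ⁻¹ : ∀ i → φ (φ⁻¹ i) ≡ i
    φφ⁻¹ i = proj₂ (surjective i) refl

  -- Regular cardinals and small types

  module Regular (κ : Ordinal u) (regular : IsRegularUncountableCardinal κ) where
    open WellOrder κ public renaming (Carrier to K)
    open OrdinalCardinality κ public

    -- Only the negative half of `I <ᶜ K`; `Small⇒<ᶜ` recovers the other half from comparability.
    Small : Set a → Set _
    Small I = ¬ (K ≤ᶜ I)

    Small-≤ᶜ : A ≤ᶜ B → Small B → Small A
    Small-≤ᶜ A≤B small K≤A = small (≤ᶜ-trans K≤A A≤B)

    Small⇒<ᶜ : Small A → A <ᶜ K
    Small⇒<ᶜ small =
      ≤ᶜ-trans (proj₂ (≰ᶜ⇒≤ᶜsegment wellFounded <-total small)) (mk≤ᶜ value value-injective) , small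

    ↓-small : ∀ γ → Small (↓ γ)
    ↓-small γ = proj₂ (proj₁ regular γ)

    -- An unbounded image would be cofinal, so regularity would give it κ elements.
    bound : Small A → (b : A → K) → ∃[ c ] (∀ i → b i < c)
    bound small b = byContradiction λ unbounded →
      Small-≤ᶜ (image≤ᶜ b) small (proj₂ (proj₂ regular) (image b) λ ξ →
        byContradiction λ ¬above → unbounded (ξ , λ i → byContradiction λ bi≮ξ →
          ¬above (b i , char⁺ (Image b) (i , refl) , bi≮ξ)))

    ⊤-small : Small ⊤
    ⊤-small K≤⊤ with () ← ≤ᶜ-injective (≤ᶜ-trans (proj₁ (proj₁ (proj₂ regular))) K≤⊤) {0} {1} refl

    above : ∀ γ → ∃[ γ′ ] (γ < γ′)
    above γ = let γ′ , lt = bound ⊤-small (λ _ → γ) in γ′ , lt tt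

    k₀ : K
    k₀ = Injection.to (proj₁ (proj₁ (proj₂ regular))) 0

    bound-↓ : ∀ γ (b : K → K) → ∃[ c ] (∀ i → i < γ → b i < c)
    bound-↓ γ b = let c , lt = bound (↓-small γ) (b ∘ value) in c , λ i i<γ → lt (i , [ i<γ ])

  -- Lexicographically monotone sequences

  -- If η-sequences of indices are bounded, then a lexicographically monotone
  -- sequence stabilises at one coordinate after the other.

  module Lexicographic (θ : Ordinal u) {K : Set u} (η : ∣ θ ∣) where
    module T = WellOrder θ

    Lex : Rel K u → Rel (T.Carrier → K) u
    Lex R v w = ∃[ δ ] (δ T.< η × (∀ ε → ε T.< δ → v ε ≡ w ε) × R (v δ) (w δ))

    -- `Q` selects the indices in use: all of κ for increasing sequences, and the elements of θ of
    -- cardinality at most |η| for decreasing ones.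
    module _ {q} (O : Ordinal u) (Q : Pred ∣ O ∣ q) (x : ∣ O ∣ → T.Carrier → K)
      (R : Rel K u) (R-irrefl : ∀ {k} → ¬ R k k)
      (bounded : (b : T.Carrier → ∣ O ∣) → (∀ δ → Q (b δ)) →
                 ∃[ c ] (Q c × (∀ δ → δ T.< η → Ordinal._<_ O (b δ) c)))
      (unbounded : ∀ c → Q c → ∃[ d ] (Q d × Ordinal._<_ O c d))
      where
      open WellOrder O

      Settled : T.Carrier → Set _
      Settled δ = ∃[ b ] (Q b × (∀ i → Q i → ¬ (i < b) → x i δ ≡ x b δ))

      -- The premise `settle` treats a single coordinate that is monotone from `c` on, where
      -- increasing and decreasing sequences differ. Once all coordinates below `η` have settled,
      -- two later members agree there, against `Lex`.
      no-monotone-sequence : ∃ Q →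
        (∀ δ → δ T.< η → ∀ c → Q c →
          (∀ i j → Q i → Q j → ¬ (i < c) → i < j → x i δ ≡ x j δ ⊎ R (x i δ) (x j δ)) →
          Settled δ) →
        (∀ i j → Q i → Q j → i < j → Lex R (x i) (x j)) → ⊥
      no-monotone-sequence (q₀ , Qq₀) settle monotone =
        let c , Qc , agree = collect η (λ ε<η → ε<η) settled
            d , Qd , c<d = unbounded c Qc
            δ , δ<η , _ , r = monotone c d Qc Qd c<d
        in R-irrefl (subst (R _) (agree δ δ<η d c Qd Qc (<-asym c<d) <-irrefl) r)
        where
        collect : ∀ ζ → (∀ {ε} → ε T.< ζ → ε T.< η) → (∀ ε → ε T.< ζ → Settled ε) →
          ∃[ c ] (Q c × (∀ ε → ε T.< ζ → ∀ i j → Q i → Q j → ¬ (i < c) → ¬ (j < c) → x i ε ≡ x j ε))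
        collect ζ ζ≤η rec =
          let c , Qc , b<c = bounded (λ ε → proj₁ (pick ε em)) (λ ε → proj₁ (proj₂ (pick ε em)))
              value-at-b = λ ε ε<ζ i Qi i≮c → proj₂ (proj₂ (pick ε em)) ε<ζ i Qi
                λ i<b → i≮c (<-trans i<b (b<c ε (ζ≤η ε<ζ)))
          in c , Qc , λ ε ε<ζ i j Qi Qj i≮c j≮c →
               trans (value-at-b ε ε<ζ i Qi i≮c) (sym (value-at-b ε ε<ζ j Qj j≮c))
          where
          pick : ∀ ε → Dec (ε T.< ζ) →
            ∃[ b ] (Q b × (ε T.< ζ → ∀ i → Q i → ¬ (i < b) → x i ε ≡ x b ε))
          pick ε (yes ε<ζ) = let b , Qb , eq = rec ε ε<ζ in b , Qb , λ _ → eq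
          -- `bounded` wants an index for every coordinate; outside `ζ` the default `q₀` carries no
          -- obligation.
          pick ε (no ε≮ζ)  = q₀ , Qq₀ , λ ε<ζ → ⊥-elim (ε≮ζ ε<ζ)
        settled : ∀ δ → δ T.< η → Settled δ
        settled = All.wfRec T.wellFounded _ (λ δ → δ T.< η → Settled δ) λ δ rec δ<η →
          let c , Qc , agree = collect δ (λ ε<δ → T.<-trans ε<δ δ<η)
                (λ ε ε<δ → rec ε<δ (T.<-trans ε<δ δ<η))
          in settle δ δ<η c Qc λ i j Qi Qj i≮c i<j →
               compare-at δ c agree i j Qi Qj i≮c (λ j<c → i≮c (<-trans i<j j<c)) (monotone i j Qi Qj i<j)
          where
          compare-at : ∀ δ c →
            (∀ ε → ε T.< δ → ∀ i j → Q i → Q j → ¬ (i < c) → ¬ (j < c) → x i ε ≡ x j ε) →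
            ∀ i j → Q i → Q j → ¬ (i < c) → ¬ (j < c) → Lex R (x i) (x j) →
            x i δ ≡ x j δ ⊎ R (x i δ) (x j δ)
          -- The first difference cannot come before `δ`, where the sequences agree already; if it
          -- comes after `δ`, the two are equal at `δ`.
          compare-at δ c agree i j Qi Qj i≮c j≮c (δ′ , _ , below , r) with T.compare δ′ δ
          ... | tri< δ′<δ _ _ = ⊥-elim (R-irrefl
                  (subst (R _) (agree δ′ δ′<δ j i Qj Qi j≮c i≮c) r))
          ... | tri≈ _ refl _ = inj₂ r
          ... | tri> _ _ δ<δ′ = inj₁ (below δ δ<δ′)

  -- Sequences of length below θ with bounded values

  module Counting (κ θ : Ordinal u) (regular : IsRegularUncountableCardinal κ)
    (θ-cardinal : IsInfiniteCardinal θ) (θ<κ : θ <ₒ κ) (arrow : OnCardinal.Arrow κ θ)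
    where
    open Regular κ regular
    open OnCardinal κ using ([_]²)
    module Θ where
      open WellOrder θ public
      open OrdinalCardinality θ public

    Θ-small : Small Θ.Carrier
    Θ-small = let b , φ , iso = θ<κ in
      Small-≤ᶜ (mk≤ᶜ φ (IsOrderIsomorphism.injective iso)) (↓-small b)

    Θ↓-small : ∀ {η} → Small (Θ.↓ η)
    Θ↓-small = Small-≤ᶜ Θ.↓-≤ᶜ Θ-small

    V : Set _
    V = Θ.Carrier → K

    -- ^η γ, with its elements extended by k₀ beyond η
    Bounded : Θ.Carrier → K → Pred V _
    Bounded η γ v = (∀ δ → δ Θ.< η → v δ < γ) × (∀ δ → ¬ (δ Θ.< η) → v δ ≡ k₀)

    cut′ : ∀ η δ → Dec (δ Θ.< η) → V → K
    cut′ η δ (yes _) v = v δ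
    cut′ η δ (no _)  v = k₀

    cut : Θ.Carrier → V → V
    cut η v δ = cut′ η δ em v

    cut-< : ∀ {η δ} v → δ Θ.< η → cut η v δ ≡ v δ
    cut-< {η} {δ} v δ<η with em {P = δ Θ.< η}
    ... | yes _  = refl
    ... | no δ≮η = ⊥-elim (δ≮η δ<η)

    cut-≮ : ∀ {η δ} v → ¬ (δ Θ.< η) → cut η v δ ≡ k₀
    cut-≮ {η} {δ} v δ≮η with em {P = δ Θ.< η}
    ... | yes δ<η = ⊥-elim (δ≮η δ<η)
    ... | no _    = refl

    cut-bounded : ∀ {η γ v} → (∀ δ → δ Θ.< η → v δ < γ) → Bounded η γ (cut η v)
    cut-bounded {v = v} v<γ =
      (λ δ δ<η → subst (_< _) (sym (cut-< v δ<η)) (v<γ δ δ<η)) , (λ δ → cut-≮ v)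

    bounded-ext : ∀ {η γ γ′ v w} → Bounded η γ v → Bounded η γ′ w →
                  (∀ δ → δ Θ.< η → v δ ≡ w δ) → v ≡ w
    bounded-ext {η} (_ , v₀) (_ , w₀) eq = ext λ δ → at δ em
      where
      at : ∀ δ → Dec (δ Θ.< η) → _
      at δ (yes δ<η) = eq δ δ<η
      at δ (no δ≮η)  = trans (v₀ δ δ≮η) (sym (w₀ δ δ≮η))

    NoInjection : Θ.Carrier → Set _
    NoInjection η = ∀ γ (e : K → V) → (∀ i → Bounded η γ (e i)) →
                    (∀ {i j} → e i ≡ e j → i ≡ j) → ⊥

    -- A sequence is its cut at `μ` together with one value below `γ`. There are fewer than κ cuts
    -- by induction, and each has a bounded set of indices over it. Regularity yields a `d` above
    -- all these bounds, although `d` lies over its own cut.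
    suc-step : ∀ {η μ} → μ Θ.< η → (∀ δ → δ Θ.< η → ¬ (μ Θ.< δ)) →
               NoInjection μ → NoInjection η
    suc-step {η} {μ} μ<η μ-max ih γ e e-bounded e-injective =
      <-irrefl (<-trans (proj₂ (fibre-bound (cut μ (e d))) d refl)
        (d> (cut μ (e d) , [ char⁺ (Image (cut μ ∘ e)) (d , refl) ])))
      where
      cuts : 𝒫 V
      cuts = image (cut μ ∘ e)
      cuts-small : Small (El cuts)
      cuts-small K≤cuts = ih γ (value ∘ Injection.to K≤cuts)
        (λ i → let j , eq = char⁻ (Image (cut μ ∘ e)) (prf (Injection.to K≤cuts i)) in
          subst (Bounded μ γ) eq
            (cut-bounded λ δ δ<μ → proj₁ (e-bounded j) δ (Θ.<-trans δ<μ μ<η)))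
        λ eq → ≤ᶜ-injective K≤cuts (value-injective eq)
      determined : ∀ {i j} → cut μ (e i) ≡ cut μ (e j) → e i μ ≡ e j μ → i ≡ j
      determined {i} {j} eq eqμ = e-injective (bounded-ext (e-bounded i) (e-bounded j) at)
        where
        at : ∀ δ → δ Θ.< η → e i δ ≡ e j δ
        at δ δ<η with Θ.≮⇒≡⊎> (μ-max δ δ<η)
        ... | inj₁ refl = eqμ
        ... | inj₂ δ<μ  = trans (sym (cut-< (e i) δ<μ)) (trans (cong (λ v → v δ) eq) (cut-< (e j) δ<μ))
      fibre-bound : ∀ v → ∃[ c ] (∀ i → cut μ (e i) ≡ v → i < c)
      fibre-bound v =
        let c , lt = bound-↓ γ (λ α → find α em) in
        c , λ i eq → subst (_< c) (find-≡ i eq em) (lt (e i μ) (proj₁ (e-bounded i) μ μ<η))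
        where
        Over : K → Pred K _
        Over α i = cut μ (e i) ≡ v × e i μ ≡ α
        find : ∀ α → Dec (∃ (Over α)) → K
        find α (yes (i , _)) = i
        find α (no _)        = k₀
        find-≡ : ∀ i → cut μ (e i) ≡ v → (dec : Dec (∃ (Over (e i μ)))) → find (e i μ) dec ≡ i
        find-≡ i eq (yes (j , eq′ , eqμ)) = determined (trans eq′ (sym eq)) eqμ
        find-≡ i eq (no none)             = ⊥-elim (none (i , eq , refl))
      d = proj₁ (bound cuts-small (λ v → proj₁ (fibre-bound (value v))))
      d> = proj₂ (bound cuts-small (λ v → proj₁ (fibre-bound (value v))))

    module LimitStep (η : Θ.Carrier) (ℕ≤η : ℕ ≤ᶜ Θ.↓ η) where
      open Lexicographic θ {K} η using (Lex; no-monotone-sequence)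

      lex-total : ∀ {γ v w} → Bounded η γ v → Bounded η γ w → v ≢ w → Lex _<_ v w ⊎ Lex _<_ w v
      lex-total {v = v} {w} v-bounded w-bounded v≢w
        with Θ.least-element (λ δ → v δ ≢ w δ) (byContradiction λ none →
          v≢w (ext λ δ → byContradiction λ neq → none (δ , neq)))
      ... | δ , neq , lst = direction (compare (v δ) (w δ))
        where
        δ<η : δ Θ.< η
        δ<η = byContradiction λ δ≮η →
          neq (trans (proj₂ v-bounded δ δ≮η) (sym (proj₂ w-bounded δ δ≮η)))
        agree : ∀ ε → ε Θ.< δ → v ε ≡ w ε
        agree ε ε<δ = byContradiction λ neq′ → lst ε neq′ ε<δ
        direction : Tri (v δ < w δ) (v δ ≡ w δ) (w δ < v δ) → _
        direction (tri< lt _ _) = inj₁ (δ , δ<η , agree , lt)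
        direction (tri≈ _ eq _) = ⊥-elim (neq eq)
        direction (tri> _ _ gt) = inj₂ (δ , δ<η , (λ ε ε<δ → sym (agree ε ε<δ)) , gt)

      -- A coordinate takes values below `γ`. For each `α < γ` exceeded from `c` on, pick an index
      -- exceeding it, and let `d` be above all the picks. A rise of the coordinate after `d` would
      -- mean that its value at `d` was exceeded before `d`.
      no-increasing : ∀ γ (x : K → V) → (∀ i → Bounded η γ (x i)) →
                      (∀ i j → i < j → Lex _<_ (x i) (x j)) → ⊥
      no-increasing γ x x-bounded increasing =
        no-monotone-sequence κ (λ _ → ⊤) x _<_ <-irrefl
          (λ b _ → let c , lt = bound Θ↓-small (b ∘ value) in c , tt , λ δ δ<η → lt (δ , [ δ<η ]))
          (λ c _ → let d , c<d = above c in d , tt , c<d)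
          (k₀ , tt) settle (λ i j _ _ → increasing i j)
        where
        settle : ∀ δ → δ Θ.< η → ∀ c → ⊤ →
          (∀ i j → ⊤ → ⊤ → ¬ (i < c) → i < j → x i δ ≡ x j δ ⊎ x i δ < x j δ) →
          ∃[ b ] (⊤ × (∀ i → ⊤ → ¬ (i < b) → x i δ ≡ x b δ))
        settle δ δ<η c _ monotone = let d , find<d = bound-↓ γ (λ α → find α em) in
          d , tt , constant d (λ α α<γ → found α em (find<d α α<γ))
            -- Any `α` below `γ` gives `c < d`; `x c δ` is one at hand.
            (c< em (find<d (x c δ) (proj₁ (x-bounded c) δ δ<η)))
          where
          Exceeds : K → Pred K _
          Exceeds α i = ¬ (i < c) × α < x i δ
          find : ∀ α → Dec (∃ (Exceeds α)) → K
          find α (yes (i , _)) = i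
          find α (no _)        = c
          found : ∀ α {d} exc? → find α exc? < d → ∃ (Exceeds α) → ∃[ i ] (Exceeds α i × i < d)
          found α (yes (i , exc)) i<d _    = i , exc , i<d
          found α (no none)       _   some = ⊥-elim (none some)
          c< : ∀ {α d} exc? → find α exc? < d → c < d
          c< (yes (i , i≮c , _)) i<d = ≮-<-trans i≮c i<d
          c< (no _)              c<d = c<d
          constant : ∀ d → (∀ α → α < γ → ∃ (Exceeds α) → ∃[ i ] (Exceeds α i × i < d)) → c < d →
                     ∀ i → ⊤ → ¬ (i < d) → x i δ ≡ x d δ
          constant d found c<d i _ i≮d with ≮⇒≡⊎> i≮d
          ... | inj₁ refl = refl
          ... | inj₂ d<i with monotone d i tt tt (<-asym c<d) d<i
          ...   | inj₁ eq = sym eq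
          ...   | inj₂ lt
                with j , (j≮c , lt′) , j<d ←
                  found (x d δ) (proj₁ (x-bounded d) δ δ<η) (i , <-asym (<-trans c<d d<i) , lt)
                with monotone j d tt tt j≮c j<d
          ...     | inj₁ eq  = ⊥-elim (<-irrefl (subst (x d δ <_) eq lt′))
          ...     | inj₂ lt″ = ⊥-elim (<-asym lt′ lt″)

      -- θ may be singular, so the argument runs along its elements of cardinality at most |η|,
      -- which `|η|⁺-bounded` shows to be closed under bounds of η-sequences. A decreasing
      -- coordinate settles where it attains its least value.
      no-decreasing : (x : Θ.Carrier → V) →
                      (∀ i j → i Θ.< j → Lex _<_ (x j) (x i)) → ⊥
      no-decreasing x decreasing =
        no-monotone-sequence θ Q x (λ α β → β < α) <-irrefl
          (Θ.|η|⁺-bounded (proj₁ θ-cardinal) η ℕ≤η)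
          (λ c Qc → let d , Qd , lt = Θ.|η|⁺-bounded (proj₁ θ-cardinal) η ℕ≤η (λ _ → c) (λ _ → Qc) in
            d , Qd , lt (value δ₀) (prf δ₀))
          (η , ↣-id _)
          settle
          λ i j _ _ i<j → let δ , δ<η , agree , lt = decreasing i j i<j in
            δ , δ<η , (λ ε ε<δ → sym (agree ε ε<δ)) , lt
        where
        Q : Pred Θ.Carrier _
        Q i = Θ.↓ i ≤ᶜ Θ.↓ η
        δ₀ = Injection.to ℕ≤η 0
        settle : ∀ δ → δ Θ.< η → ∀ c → Q c →
          (∀ i j → Q i → Q j → ¬ (i Θ.< c) → i Θ.< j → x i δ ≡ x j δ ⊎ x j δ < x i δ) →
          ∃[ b ] (Q b × (∀ i → Q i → ¬ (i Θ.< b) → x i δ ≡ x b δ))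
        settle δ δ<η c Qc monotone
          with least-element (λ α → ∃[ i ] (Q i × ¬ (i Θ.< c) × x i δ ≡ α)) (_ , c , Qc , Θ.<-irrefl , refl)
        ... | _ , (b , Qb , b≮c , refl) , lst = b , Qb , constant
          where
          constant : ∀ i → Q i → ¬ (i Θ.< b) → x i δ ≡ x b δ
          constant i Qi i≮b with Θ.≮⇒≡⊎> i≮b
          ... | inj₁ refl = refl
          ... | inj₂ b<i with monotone b i Qb Qi b≮c b<i
          ...   | inj₁ eq = sym eq
          ...   | inj₂ lt = ⊥-elim (lst _ (i , Qi , (λ i<c → b≮c (Θ.<-trans b<i i<c)) , refl) lt)

      -- Sierpiński's colouring compares the lexicographic order with that of κ.
      Descends : (K → V) → K × K → Set _
      Descends e (i , j) = Lex _<_ (e j) (e i)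

      no-injection : NoInjection η
      no-injection γ e e-bounded e-injective
        with arrow (λ p → shade (em {P = Descends e (value p)}))
      ... | X , inj₁ (X≅κ , constant) =
        let ψ , ψ∈X , ψ-mono = HasOrderType⇒enumeration κ X≅κ in
        no-increasing γ (e ∘ ψ) (e-bounded ∘ ψ) λ i j i<j →
          ascends (ψ-mono i j i<j) (shade≡0 em (constant ((ψ i , ψ j) , [ (tt , tt , ψ-mono i j i<j) ])
            (ψ∈X i , ψ∈X j , ψ-mono i j i<j)))
        where
        ascends : ∀ {i j} → i < j → ¬ Descends e (i , j) → Lex _<_ (e i) (e j)
        ascends {i} {j} i<j ¬gt with lex-total (e-bounded i) (e-bounded j)
                  (λ eq → <-irrefl (subst (i <_) (sym (e-injective eq)) i<j))
        ... | inj₁ lt = lt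
        ... | inj₂ gt = ⊥-elim (¬gt gt)
      ... | X , inj₂ (X≅θ , constant) =
        let ψ , ψ∈X , ψ-mono = HasOrderType⇒enumeration θ X≅θ in
        no-decreasing (e ∘ ψ) λ i j i<j →
          shade≡1 em (constant ((ψ i , ψ j) , [ (tt , tt , ψ-mono i j i<j) ])
            (ψ∈X i , ψ∈X j , ψ-mono i j i<j))

    -- Sierpiński's colouring needs an infinite `η`. A nonzero `η` without a last element below it
    -- receives ω; the zero and successor cases are counted directly.
    no-injection : ∀ η → NoInjection η
    no-injection = All.wfRec Θ.wellFounded _ NoInjection step
      where
      step : ∀ η → (∀ {μ} → μ Θ.< η → NoInjection μ) → NoInjection η
      step η rec with em {P = ∃[ μ ] (μ Θ.< η × (∀ δ → δ Θ.< η → ¬ (μ Θ.< δ)))}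
      ... | yes (μ , μ<η , μ-max) = suc-step μ<η μ-max (rec μ<η)
      ... | no ¬max with em {P = ∃[ δ ] (δ Θ.< η)}
      ...   | no empty = λ γ e e-bounded e-injective →
        let k , k₀<k = above k₀ in
        <-irrefl (subst (k₀ <_) (e-injective (bounded-ext (e-bounded k) (e-bounded k₀)
          λ δ δ<η → ⊥-elim (empty (δ , δ<η)))) k₀<k)
      ...   | yes (δ₀ , δ₀<η) = LimitStep.no-injection η (mk≤ᶜ f f-injective)
        where
        later : ∀ δ → δ Θ.< η → ∃[ ε ] (ε Θ.< η × δ Θ.< ε)
        later δ δ<η = byContradiction λ ¬later →
          ¬max (δ , δ<η , λ ε ε<η δ<ε → ¬later (ε , ε<η , δ<ε))
        f : ℕ → Θ.↓ η
        f zero    = δ₀ , [ δ₀<η ]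
        f (suc n) = let ε , ε<η , _ = later (value (f n)) (prf (f n)) in ε , [ ε<η ]
        f-suc : ∀ n → value (f n) Θ.< value (f (suc n))
        f-suc n = proj₂ (proj₂ (later (value (f n)) (prf (f n))))
        f-mono : ∀ {m n} → m <′ n → value (f m) Θ.< value (f n)
        f-mono {m} <′-base               = f-suc m
        f-mono {n = suc n} (≤′-step m<n) = Θ.<-trans (f-mono m<n) (f-suc n)
        f-injective : ∀ {m n} → f m ≡ f n → m ≡ n
        f-injective {m} {n} eq with <-cmp m n
        ... | tri< lt _ _ = ⊥-elim (Θ.<-irrefl
          (subst (λ p → value (f m) Θ.< value p) (sym eq) (f-mono {m} {n} (<⇒<′ lt))))
        ... | tri≈ _ eq′ _ = eq′
        ... | tri> _ _ gt = ⊥-elim (Θ.<-irrefl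
          (subst (λ p → value (f n) Θ.< value p) eq (f-mono {n} {m} (<⇒<′ gt))))

  -- Order types of images, and null sets of a κ-complete ideal

  image-hasOrderType : {R : Rel A ℓ} (α : Ordinal u) → (∀ {x y} → R x y → ¬ R y x) →
    (c : ∣ α ∣ → A) → (∀ {i j} → Ordinal._<_ α i j → R (c i) (c j)) →
    HasOrderType (image c) R α
  image-hasOrderType {R = R} α asym c mono = φ , record
    { isOrderMonomorphism = record
      { isOrderHomomorphism = record
        { cong = cong φ
        ; mono = λ {x} {y} r → reflects (subst₂ R (sym (cφ x)) (sym (cφ y)) r)
        }
      ; injective = λ {x} {y} eq → value-injective (trans (sym (cφ x)) (trans (cong c eq) (cφ y)))
      ; cancel    = λ {x} {y} lt → subst₂ R (cφ x) (cφ y) (mono lt)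
      }
    ; surjective = λ i → let e = c i , [ char⁺ (Image c) (i , refl) ] in
        e , λ { refl → c-injective (cφ e) }
    }
    where
    open WellOrder α
    φ : El (image c) → Carrier
    φ e = proj₁ (char⁻ (Image c) (prf e))
    cφ : ∀ e → c (φ e) ≡ value e
    cφ e = proj₂ (char⁻ (Image c) (prf e))
    irrefl : ∀ {x} → ¬ R x x
    irrefl r = asym r r
    reflects : ∀ {i j} → R (c i) (c j) → i < j
    reflects {i} {j} r with compare i j
    ... | tri< lt _ _   = lt
    ... | tri≈ _ refl _ = ⊥-elim (irrefl r)
    ... | tri> _ _ gt   = ⊥-elim (asym r (mono gt))
    c-injective : ∀ {i j} → c i ≡ c j → i ≡ j
    c-injective {i} {j} eq with compare i j
    ... | tri< lt _ _ = ⊥-elim (irrefl (subst (R (c i)) (sym eq) (mono lt)))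
    ... | tri≈ _ eq′ _ = eq′
    ... | tri> _ _ gt = ⊥-elim (irrefl (subst (R (c j)) eq (mono gt)))

  module NullSets (κ : Ordinal u) (regular : IsRegularUncountableCardinal κ)
    {S : Set a} (H : 𝒫 (𝒫 S)) (H-complete : IsCompleteIdeal κ H)
    where
    open Regular κ regular using (Small; Small⇒<ᶜ; Small-≤ᶜ)
    open IsCompleteIdeal H-complete
    open IsIdeal isIdeal

    -- `H` has only Boolean-valued sets as members; this extends membership to predicates of every
    -- level.
    Null : Pred S ℓ → Set
    Null P = char P ∈ ⟪ H ⟫

    Null-⊆ : {P : Pred S ℓ} {Q : Pred S ℓ′} → P ⊆ Q → Null Q → Null P
    Null-⊆ {P = P} {Q} P⊆Q = downward λ x → char⁺ Q (P⊆Q (char⁻ P x))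

    ∈⇒Null : ∀ {X} → X ∈ ⟪ H ⟫ → Null ⟪ X ⟫
    ∈⇒Null {X} = downward (char⁻ ⟪ X ⟫)

    Null⇒∈ : ∀ {X} → Null ⟪ X ⟫ → X ∈ ⟪ H ⟫
    Null⇒∈ {X} = downward (char⁺ ⟪ X ⟫)

    Null-∪ : {P : Pred S ℓ} {Q : Pred S ℓ′} → Null P → Null Q → Null (λ x → P x ⊎ Q x)
    Null-∪ {P = P} {Q} nullP nullQ = downward
      (λ x → Equivalence.from T-∨ (Sum.map (char⁺ P) (char⁺ Q) (char⁻ (λ x → P x ⊎ Q x) x)))
      (union nullP nullQ)

    Null-⋃ : {I : Set b} {P : I → Pred S ℓ} → Small I → (∀ i → Null (P i)) → Null (λ x → ∃[ i ] P i x)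
    Null-⋃ {I = I} {P} small null = Null-⊆
      (λ (i , p) → char (P i) , char⁺ (Image sets) (i , refl) , char⁺ (P i) p)
      (complete (image sets)
        (λ X∈ → let i , eq = char⁻ (Image sets) X∈ in subst (_∈ ⟪ H ⟫) eq (null i))
        (Small⇒<ᶜ (Small-≤ᶜ (image≤ᶜ sets) small))
        (char⁻ (⋃ (image sets)) , char⁺ (⋃ (image sets))))
      where
      sets : I → 𝒫 S
      sets i = char (P i)

    Null-⊥ : S → {P : Pred S ℓ} → (∀ x → ¬ P x) → Null P
    Null-⊥ x ¬P = Null-⊆ {Q = _≡ x} (λ {y} p → ⊥-elim (¬P y p))
      (singletons x ((λ y → sym (char⁻ (_≡ x) y)) , λ y → char⁺ (_≡ x) (sym y)))

  -- Weakly selective ideals on κ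

  module Selectivity (κ : Ordinal u) (regular : IsRegularUncountableCardinal κ) where
    open Regular κ regular
    open OnCardinal κ

    -- A base bounds the cofinality from above, whereas `IsNonWeaklySelective` speaks of the exact
    -- value. `least-cardinality` supplies a smallest base, and a failure would put its size between
    -- `ν` and `μ`.
    small-cof⇒weaklySelective : ∀ {μ ν : Set u} → IsNonWeaklySelective ν → μ <ᶜ ν →
      ∀ J → IsCompleteIdeal κ J → ∀ 𝒳 → Generates 𝒳 J → El 𝒳 ≤ᶜ μ → WeaklySelective J
    small-cof⇒weaklySelective (_ , ν-least) (_ , ν≰μ) J J-complete 𝒳 gen 𝒳≤μ =
      byContradiction λ ¬selective →
        let (𝒳₀ , gen₀) , min = least-cardinality {I = ∃[ 𝒴 ] Generates 𝒴 J} (El ∘ proj₁) (𝒳 , gen)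
            ν≤𝒳₀ = ν-least (El 𝒳₀)
              (J , J-complete , ((𝒳₀ , gen₀ , ↔-id _) , λ 𝒴 gen′ → min (𝒴 , gen′)) , ¬selective)
        in ν≰μ (≤ᶜ-trans ν≤𝒳₀ (≤ᶜ-trans (min (𝒳 , gen)) 𝒳≤μ))

    -- Each β is sent to its first R-predecessor; on a set where this map is
    -- sparse enough every R-predecessor of β lies too high to be in the set.

    weaklySelective⇒free : ∀ J (J-complete : IsCompleteIdeal κ J) → WeaklySelective J →
      let open NullSets κ regular J J-complete using (Null) in
      (R : Rel K u) (S : 𝒫 K) → S ∈ J ⁺ᴵ →
      (∀ α → Null (λ β → α ∈ ⟪ S ⟫ × α < β × R α β)) →
      ∃[ Y ] (Y ∈ J ⁺ᴵ × ⟪ Y ⟫ ⊆ ⟪ S ⟫ × (∀ {α β} → α ∈ ⟪ Y ⟫ → β ∈ ⟪ Y ⟫ → α < β → ¬ R α β))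
    weaklySelective⇒free J J-complete (weakP , weakQ) R S S⁺ null =
      let B , B⁺ , B⊆S , sparse = weakP S (λ β → first (value β) em) S⁺ fibre-null
      in thin B B⁺ B⊆S λ α → proj₂ (sparse α)
      where
      open NullSets κ regular J J-complete
      Pre : K → Pred K u
      Pre β α = α ∈ ⟪ S ⟫ × α < β × R α β
      first : ∀ β → Dec (∃ (Pre β)) → K
      first β (yes pre) = proj₁ (least-element (Pre β) pre)
      -- With this default a point without predecessors adds only `α` itself to the fibre over `α`,
      -- so fibres stay null.
      first β (no _)    = β
      first-spec : ∀ β pre? → Pre β (first β pre?) ⊎ first β pre? ≡ β
      first-spec β (yes pre) = inj₁ (proj₁ (proj₂ (least-element (Pre β) pre)))
      first-spec β (no _)    = inj₂ refl
      first-≤ : ∀ {α β} pre? → Pre β α → ¬ (α < first β pre?)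
      first-≤ {α} {β} (yes pre) p = proj₂ (proj₂ (least-element (Pre β) pre)) α p
      first-≤ (no ¬pre) p = ⊥-elim (¬pre (_ , p))
      fibre-null : ∀ α {Z} → ⟪ Z ⟫ ≐ Fibre S (λ β → first (value β) em) α → Z ∈ ⟪ J ⟫
      fibre-null α (Z⊆ , _) = Null⇒∈ (Null-⊆ {Q = λ β → Pre β α ⊎ β ≡ α}
        (λ {β} β∈Z → spec β (proj₂ (Z⊆ β∈Z)))
        (Null-∪ (null α) (IsIdeal.singletons (IsCompleteIdeal.isIdeal J-complete) α
          ((λ y → sym (char⁻ (_≡ α) y)) , λ y → char⁺ (_≡ α) (sym y)))))
        where
        spec : ∀ β → first β em ≡ α → Pre β α ⊎ β ≡ α
        spec β refl = Sum.map id sym (first-spec β em)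
      thin : ∀ B → B ∈ J ⁺ᴵ → ⟪ B ⟫ ⊆ ⟪ S ⟫ →
        (∀ α → Small [ ξ ∈ K ∣ (ξ ∈ ⟪ B ⟫ × ξ ∈ Fibre S (λ β → first (value β) em) α) ]) →
        ∃[ Y ] (Y ∈ J ⁺ᴵ × ⟪ Y ⟫ ⊆ ⟪ S ⟫ × (∀ {α β} → α ∈ ⟪ Y ⟫ → β ∈ ⟪ Y ⟫ → α < β → ¬ R α β))
      thin B B⁺ B⊆S sparse =
        let C , C⁺ , g< = weakQ B B⁺ g
            C∩B = λ {α} (α∈Y : α ∈ ⟪ C ∩ B ⟫) → Equivalence.to T-∧ α∈Y
        in C ∩ B , C⁺ , (λ α∈Y → B⊆S (proj₂ (C∩B α∈Y))) , λ α∈Y β∈Y α<β r →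
          <-asym (g< _ _ (proj₁ (C∩B α∈Y) , proj₁ (C∩B β∈Y) , α<β))
            (<g _ _ (proj₂ (C∩B β∈Y)) (B⊆S (proj₂ (C∩B β∈Y)))
              (first-≤ em (B⊆S (proj₂ (C∩B α∈Y)) , α<β , r)))
        where
        fibre-bound : ∀ α → ∃[ c ] (∀ i → value i < c)
        fibre-bound α = bound (sparse α) value
        -- Being below `above α` covers all `i` up to and including `α`. So `g α` exceeds every `β`
        -- in `B` whose first predecessor is at most `α`, while on `C` the Q-point property puts
        -- `g α` below each later `β`.
        g-bound : ∀ α → ∃[ c ] (∀ i → i < proj₁ (above α) → proj₁ (fibre-bound i) < c)
        g-bound α = bound-↓ (proj₁ (above α)) (proj₁ ∘ fibre-bound)
        g : K → K
        g α = proj₁ (g-bound α)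
        <g : ∀ α β → β ∈ ⟪ B ⟫ → β ∈ ⟪ S ⟫ → ¬ (α < first β em) → β < g α
        <g α β β∈B β∈S α≮ = <-trans
          (proj₂ (fibre-bound (first β em)) (β , [ (β∈B , β∈S , refl) ]))
          (proj₂ (g-bound α) (first β em) (≮-<-trans α≮ (proj₂ (above α))))

  -- The map from a to ⋃(a ∩ κ)

  module Pκλ-Ideal (κ Λ : Ordinal u) (regular : IsRegularUncountableCardinal κ) (κ<Λ : κ <ₒ Λ) where
    open Regular κ regular
    open OnPκλ κ Λ κ<Λ public
    open Selectivity κ regular

    upper : ∀ α β → ∃[ γ ] (α < γ × β < γ)
    upper α β with compare α β
    ... | tri< α<β _ _    = let γ , β<γ = above β in γ , <-trans α<β β<γ , β<γ
    ... | tri≈ _ refl _   = let γ , β<γ = above β in γ , β<γ , β<γ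
    ... | tri> _ _ β<α    = let γ , α<γ = above α in γ , α<γ , <-trans β<α α<γ

    private
      ι : K → Ordinal.Carrier Λ
      ι = embed κ Λ κ<Λ

      ι-injective : ∀ {ξ η} → ι ξ ≡ ι η → ξ ≡ η
      ι-injective eq = IsOrderIsomorphism.injective (proj₂ (proj₂ κ<Λ)) (value-injective eq)

    Is⋃∩κ-unique : ∀ {a σ τ} → Is⋃∩κ a σ → Is⋃∩κ a τ → σ ≡ τ
    Is⋃∩κ-unique {σ = σ} {τ} (σ⊆ , ⊆σ) (τ⊆ , ⊆τ) with compare σ τ
    ... | tri< σ<τ _ _ = ⊥-elim (<-irrefl (⊆σ (τ⊆ σ<τ)))
    ... | tri≈ _ eq _  = eq
    ... | tri> _ _ τ<σ = ⊥-elim (<-irrefl (⊆τ (σ⊆ τ<σ)))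

    Below∩κ : Pκλ → Pred K _
    Below∩κ a ξ = ∃[ η ] (η ∈ ⟪ a ∩κ ⟫ × ξ < η)

    -- Regularity bounds `a ∩κ`, so there is a least ordinal outside the union, and the union is
    -- that ordinal.
    ∃-⋃∩κ : ∀ a → ∃ (Is⋃∩κ a)
    ∃-⋃∩κ a =
      let c , <c = bound a∩κ-small value
          σ , ¬below , lst = least-element (λ σ → ¬ Below∩κ a σ)
            (c , λ (η , η∈a , c<η) → <-asym c<η (<c (η , [ η∈a ])))
      in σ , (λ {ξ} ξ<σ → byContradiction λ ¬below-ξ → lst ξ ¬below-ξ ξ<σ)
           , (λ (η , η∈a , ξ<η) → <-≮-trans ξ<η λ σ<η → ¬below (η , η∈a , σ<η))
      where
      a∩κ-small : Small (El (a ∩κ))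
      a∩κ-small = Small-≤ᶜ
        (mk≤ᶜ (λ η → ι (value η) , [ prf η ]) λ eq → value-injective (ι-injective (cong value eq)))
        (proj₂ (prf a))

    abstract
      sup : Pκλ → K
      sup a = proj₁ (∃-⋃∩κ a)

      sup-spec : ∀ a → Is⋃∩κ a (sup a)
      sup-spec a = proj₂ (∃-⋃∩κ a)

    singleton : K → Pκλ
    singleton ξ = char (_≡ ι ξ) , [ Small⇒<ᶜ (Small-≤ᶜ
      (mk≤ᶜ {B = ⊤} (λ _ → tt) λ {x} {y} _ → value-injective
        (trans (char⁻ (_≡ ι ξ) (prf x)) (sym (char⁻ (_≡ ι ξ) (prf y))))) ⊤-small) ]

    singleton⊑⇒<sup : ∀ {ξ η a} → ξ < η → singleton η ⊑ a → ξ < sup a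
    singleton⊑⇒<sup {η = η} {a} ξ<η η⊑a = proj₂ (sup-spec a) (η , η⊑a (char⁺ (_≡ ι η) {ι η} refl) , ξ<η)

    ≺⇒sup< : ∀ {a b} → a ≺ b → sup a < sup b
    ≺⇒sup< {a} {b} (_ , _ , _ , is-σ , is-τ , σ<τ) =
      subst₂ _<_ (Is⋃∩κ-unique {a} is-σ (sup-spec a)) (Is⋃∩κ-unique {b} is-τ (sup-spec b)) σ<τ

    sup<⇒≺ : ∀ {a b} → a ⊑ b → sup a < sup b → a ≺ b
    sup<⇒≺ {a} {b} a⊑b lt = a⊑b , sup a , sup b , sup-spec a , sup-spec b , lt

    -- Free sets and the ideal they induce on κ

    module _ (H : 𝒫 (𝒫 Pκλ)) (H-ideal : IsFineCompleteIdeal H)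
      (cofH non : Set u) (cof-H : IsCof H cofH) (non-ws : OnCardinal.IsNonWeaklySelective κ non)
      (cofH<non : cofH <ᶜ non) (Red : K → K → Set u)
      where
      private
        module N = NullSets κ regular H (proj₁ H-ideal)
      open N using (Null; Null-⊆; Null-∪; Null-⋃; ∈⇒Null; Null⇒∈)

      Null-⋢ : ∀ a → Null (λ b → ¬ (a ⊑ b))
      Null-⋢ a = proj₂ H-ideal (a , λ b → char⁻ (λ b → ¬ (a ⊑ b)) {b})

      -- By fineness almost every `a` contains a fixed `η` above `ξ`.
      Null-sup : ∀ ξ → Null (λ a → ¬ (ξ < sup a))
      Null-sup ξ = let η , ξ<η = above ξ in
        Null-⊆ (λ {a} ξ≮ η⊑a → ξ≮ (singleton⊑⇒<sup {a = a} ξ<η η⊑a)) (Null-⋢ (singleton η))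

      Null-⊥ : {P : Pred Pκλ ℓ} → (∀ a → ¬ P a) → Null P
      Null-⊥ = N.Null-⊥ (singleton k₀)

      Over : 𝒫 Pκλ → Pred K _
      Over B ξ = ∃[ b ] (b ∈ ⟪ B ⟫ × sup b ≡ ξ)

      Free : 𝒫 Pκλ → K → Pred Pκλ _
      Free B γ a = a ∈ ⟪ B ⟫ × (∀ ξ → Over B ξ → ξ < γ → ξ < sup a → ¬ Red ξ (sup a))

      HasFreeSubset : 𝒫 Pκλ → Set _
      HasFreeSubset A = ∃[ B ] (⟪ B ⟫ ⊆ ⟪ A ⟫ × B ∈ H ⁺ᴵ ×
        (∀ {a b} → a ∈ ⟪ B ⟫ → b ∈ ⟪ B ⟫ → sup a < sup b → ¬ Red (sup a) (sup b)))

      Free-antitone : ∀ {B γ δ} → ¬ (δ < γ) → Free B δ ⊆ Free B γ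
      Free-antitone δ≮γ (a∈B , free) = a∈B , λ ξ over ξ<γ → free ξ over (<-≮-trans ξ<γ δ≮γ)

      module FreeIdeal (B : 𝒫 Pκλ) (Free⁺ : ∀ γ → ¬ Null (Free B γ)) where

        Small-on-Free : 𝒫 K → K → Set
        Small-on-Free X γ = Null (λ a → Free B γ a × sup a ∈ ⟪ X ⟫)

        -- `Free B γ` shrinks as `γ` grows, so these sets form an increasing union, over `γ`, of the
        -- projections along `sup` of `H` restricted to `Free B γ`. Regularity, bounding fewer than
        -- κ witnesses `γ`, makes the union κ-complete.
        InJ : 𝒫 K → Set u
        InJ X = ∃ (Small-on-Free X)

        J : 𝒫 (𝒫 K)
        J = char InJ

        InJ-null : (X : 𝒫 K) (γ : K) {P : Pred Pκλ ℓ} →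
                   (∀ {a} → Free B γ a → sup a ∈ ⟪ X ⟫ → P a) → Null P → X ∈ ⟪ J ⟫
        InJ-null X γ ⊆P null = char⁺ InJ {X} (γ , Null-⊆ (λ (free , a∈X) → ⊆P free a∈X) null)

        J⁻ : ∀ X → X ∈ ⟪ J ⟫ → InJ X
        J⁻ X = char⁻ InJ {X}

        J-complete : IsCompleteIdeal κ J
        J-complete = record
          { isIdeal = record
            { singletons = λ ξ {X} (X⊆ , _) → InJ-null X k₀
                (λ _ a∈X ξ<a → <-irrefl (subst (_< _) (X⊆ a∈X) ξ<a)) (Null-sup ξ)
            ; downward = λ {X} {Y} X⊆Y Y∈J → let γ , null = J⁻ Y Y∈J in
                InJ-null X γ (λ free a∈X → free , X⊆Y a∈X) null
            ; union = λ {X} {Y} X∈J Y∈J →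
                let γ , nullX = J⁻ X X∈J
                    δ , nullY = J⁻ Y Y∈J
                    ε , γ<ε , δ<ε = upper γ δ
                in InJ-null (X ∪ Y) ε
                  (λ free a∈X∪Y → Sum.map (Free-antitone (<-asym γ<ε) free ,_)
                    (Free-antitone (<-asym δ<ε) free ,_) (Equivalence.to T-∨ a∈X∪Y))
                  (Null-∪ nullX nullY)
            ; proper = λ full∈J → let γ , null = J⁻ full full∈J in
                Free⁺ γ (Null-⊆ (λ free → free , tt) null)
            }
          ; complete = λ 𝒳 𝒳⊆J (_ , small) {X} (X⊆⋃ , _) →
              let index = λ (Y : El 𝒳) → J⁻ (value Y) (𝒳⊆J (prf Y))
                  γ , index<γ = bound small (proj₁ ∘ index)
              in InJ-null X γ
                (λ {a} free a∈X → let Y , Y∈𝒳 , a∈Y = X⊆⋃ a∈X in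
                  (Y , [ Y∈𝒳 ]) , Free-antitone (<-asym (index<γ (Y , [ Y∈𝒳 ]))) free , a∈Y)
                (Null-⋃ small (proj₂ ∘ index))
          }

        -- A single member C of a base of H codes a member of J together with its
        -- witness γ, namely the least sup of a point outside C. So a base of H
        -- induces a base of J of at most the same size.

        least-sup-outside : (C : 𝒫 Pκλ) → Dec (∃[ a ] (a ∉ ⟪ C ⟫)) → K
        least-sup-outside C (yes (a , a∉C)) =
          proj₁ (least-element (λ σ → ∃[ a ] (a ∉ ⟪ C ⟫ × sup a ≡ σ)) (sup a , a , a∉C , refl))
        -- This default concerns only the full set, which properness keeps out of `H`.
        least-sup-outside C (no _) = k₀

        mex : 𝒫 Pκλ → K
        mex C = least-sup-outside C em

        ≤mex : ∀ {C γ} → C ∈ ⟪ H ⟫ → (∀ {a} → ¬ (γ < sup a) → a ∈ ⟪ C ⟫) → ¬ (mex C < γ)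
        ≤mex {C} {γ} C∈H ⊆C = at em
          where
          at : ∀ out? → ¬ (least-sup-outside C out? < γ)
          at (yes (a , a∉C)) mex<γ
            with least-element (λ σ → ∃[ a ] (a ∉ ⟪ C ⟫ × sup a ≡ σ)) (sup a , a , a∉C , refl)
          ... | _ , (b , b∉C , refl) , _ = b∉C (⊆C (<-asym mex<γ))
          at (no none) _ = IsIdeal.proper (IsCompleteIdeal.isIdeal (proj₁ H-ideal))
            (Null⇒∈ (Null-⊆ (λ {a} _ → byContradiction λ a∉C → none (a , a∉C)) (∈⇒Null C∈H)))

        -- The largest set whose preimage under `sup` within `Free B (mex C)` is included in `C`.
        Trace : 𝒫 Pκλ → Pred K _
        Trace C ξ = ∀ a → Free B (mex C) a → sup a ≡ ξ → a ∈ ⟪ C ⟫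

        𝒳 : 𝒫 (𝒫 Pκλ)
        𝒳 = proj₁ (proj₁ cof-H)

        traces : 𝒫 (𝒫 K)
        traces = image (λ (C : El 𝒳) → char (Trace (value C)))

        traces≤cofH : El traces ≤ᶜ cofH
        traces≤cofH = ≤ᶜ-trans (image≤ᶜ _) (↔⇒↣ (proj₂ (proj₂ (proj₁ cof-H))))

        traces-generate : Generates traces J
        traces-generate = traces⊆J , (λ {X} → covered X) ,
          λ { {X} (Y , Y∈ , X⊆Y) →
            IsIdeal.downward (IsCompleteIdeal.isIdeal J-complete) {X} {Y} X⊆Y (traces⊆J {Y} Y∈) }
          where
          𝒳-generates : Generates 𝒳 H
          𝒳-generates = proj₁ (proj₂ (proj₁ cof-H))
          traces⊆J : ⟪ traces ⟫ ⊆ ⟪ J ⟫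
          traces⊆J X∈ with char⁻ (Image (λ (C : El 𝒳) → char (Trace (value C)))) X∈
          ... | C , refl = InJ-null (char (Trace (value C))) (mex (value C))
            (λ {a} free a∈ → char⁻ (Trace (value C)) {sup a} a∈ a free refl)
            (∈⇒Null (proj₁ 𝒳-generates (prf C)))
          covered : ∀ X → X ∈ ⟪ J ⟫ → ∃[ Y ] (Y ∈ ⟪ traces ⟫ × ⟪ X ⟫ ⊆ ⟪ Y ⟫)
          covered X X∈J =
            let γ , null = J⁻ X X∈J
                -- Putting the null set of points with `sup` at most `γ` into `C` is what forces
                -- `mex C` to be at least `γ`.
                C , C∈𝒳 , ⊆C = proj₁ (proj₂ 𝒳-generates) (Null-∪ null (Null-sup γ))
                in-C = λ {a} p → ⊆C {a} (char⁺ (λ a → (Free B γ a × sup a ∈ ⟪ X ⟫) ⊎ ¬ (γ < sup a)) p)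
            in char (Trace C) , char⁺ (Image (λ (C : El 𝒳) → char (Trace (value C)))) ((C , [ C∈𝒳 ]) , refl)
             , λ {ξ} ξ∈X → char⁺ (Trace C) λ a free eq →
                 in-C (inj₁ (Free-antitone (≤mex (proj₁ 𝒳-generates C∈𝒳) (λ γ≮ → in-C (inj₂ γ≮))) free
                   , subst (_∈ ⟪ X ⟫) (sym eq) ξ∈X))

        hasFreeSubset : HasFreeSubset B
        hasFreeSubset =
          let Y , Y⁺ , Y⊆S , free = weaklySelective⇒free J J-complete
                (small-cof⇒weaklySelective non-ws cofH<non J J-complete traces traces-generate traces≤cofH)
                Red S S⁺ S-null
              B′ = λ a → a ∈ ⟪ B ⟫ × sup a ∈ ⟪ Y ⟫
          in char B′ , (λ a∈ → proj₁ (char⁻ B′ a∈))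
             -- `Free B k₀` is included in `B`, so a null preimage of `Y` in `B` would put `Y` into
             -- `J`.
             , (λ null → Y⁺ (InJ-null Y k₀ (λ (a∈B , _) a∈Y → a∈B , a∈Y) null))
             , λ a∈ b∈ → free (proj₂ (char⁻ B′ a∈)) (proj₂ (char⁻ B′ b∈))
          where
          S : 𝒫 K
          S = char (Over B)
          S⁺ : S ∈ J ⁺ᴵ
          S⁺ S∈J = let γ , null = J⁻ S S∈J in
            Free⁺ γ (Null-⊆ (λ {a} free → free , char⁺ (Over B) (a , proj₁ free , refl)) null)
          S-null : ∀ α → char (λ β → α ∈ ⟪ S ⟫ × α < β × Red α β) ∈ ⟪ J ⟫
          -- Once `γ` exceeds `α`, no point of `Free B γ` is red with `α`, so the set to be measured
          -- is empty.
          S-null α = let γ , α<γ = above α in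
            InJ-null (char (λ β → α ∈ ⟪ S ⟫ × α < β × Red α β)) γ {P = λ _ → ⊥}
              (λ {a} (_ , ¬red) a∈ → let α∈S , α<a , red = char⁻ (λ β → α ∈ ⟪ S ⟫ × α < β × Red α β) a∈ in
                ¬red α (char⁻ (Over B) α∈S) α<γ α<a red)
              (Null-⊥ λ _ ())

      eventually-red : ∀ {A} → ¬ HasFreeSubset A → ∀ {B} → ⟪ B ⟫ ⊆ ⟪ A ⟫ → ∃[ γ ] Null (Free B γ)
      eventually-red ¬free {B} B⊆A = byContradiction λ ¬null →
        let C , C⊆B , C⁺ , free = FreeIdeal.hasFreeSubset B (λ γ null → ¬null (γ , null)) in
        ¬free (C , (λ x → B⊆A (C⊆B x)) , C⁺ , free)

      -- The tree of choices and its branches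

      -- If A has no free subset, every a ∈ A reads off a sequence of ordinals x η a:
      -- among the points of A with the same sequence below η, the canonical one over
      -- x η a lies below a and is joined to it. Almost no a gets stuck before θ.

      module Tree (θ : Ordinal u) (θ-cardinal : IsInfiniteCardinal θ) (θ<κ : θ <ₒ κ)
        (arrow : OnCardinal.Arrow κ θ) (A : 𝒫 Pκλ) (A⁺ : A ∈ H ⁺ᴵ) (¬free : ¬ HasFreeSubset A)
        where
        open Counting κ θ regular θ-cardinal θ<κ arrow

        select : (B : 𝒫 Pκλ) (ξ : K) → Dec (Over B ξ) → Pκλ
        select B ξ (yes (b , _)) = b
        select B ξ (no _)        = singleton k₀

        -- The representative depends on `B` and `ξ` alone, so almost every `a` includes all
        -- representatives over the `ξ` below a given bound.
        pick : 𝒫 Pκλ → K → Pκλ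
        pick B ξ = select B ξ em

        pick-spec : ∀ {B ξ} → Over B ξ → pick B ξ ∈ ⟪ B ⟫ × sup (pick B ξ) ≡ ξ
        pick-spec {B} {ξ} over = at em
          where
          at : ∀ over? → select B ξ over? ∈ ⟪ B ⟫ × sup (select B ξ over?) ≡ ξ
          at (yes (_ , spec)) = spec
          at (no ¬over)       = ⊥-elim (¬over over)

        Good : 𝒫 Pκλ → Pκλ → Pred K _
        Good B a ξ = pick B ξ ∈ ⟪ B ⟫ × sup (pick B ξ) ≡ ξ × pick B ξ ⊑ a × ξ < sup a × Red ξ (sup a)

        leastGood : ∀ B a → Dec (∃ (Good B a)) → Maybe K
        leastGood B a (yes good) = just (proj₁ (least-element (Good B a) good))
        leastGood B a (no _)     = nothing

        next : 𝒫 Pκλ → Pκλ → Maybe K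
        next B a = leastGood B a em

        next-good : ∀ {B a α} → next B a ≡ just α → Good B a α
        next-good {B} {a} = at em
          where
          at : ∀ {α} good? → leastGood B a good? ≡ just α → Good B a α
          at (yes good) refl = proj₁ (proj₂ (least-element (Good B a) good))

        next-≤ : ∀ {B a ξ} → Good B a ξ → ∃[ α ] (¬ (ξ < α) × next B a ≡ just α)
        next-≤ {B} {a} {ξ} good = at em
          where
          at : ∀ good? → ∃[ α ] (¬ (ξ < α) × leastGood B a good? ≡ just α)
          at (yes good′) = let α , _ , lst = least-element (Good B a) good′ in α , lst ξ good , refl
          at (no ¬good)  = ⊥-elim (¬good (ξ , good))

        Agree : ∀ η → (∀ ε → ε Θ.< η → Pκλ → Maybe K) → Pκλ → Pred Pκλ _
        Agree η rec a b = b ∈ ⟪ A ⟫ × (∀ ε ε<η → rec ε ε<η b ≡ rec ε ε<η a)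

        -- The recursion yields each `x η` as a function on all of P_κ(λ) at once, because the class
        -- of `a` compares its earlier values with those of other points.
        step : ∀ η → WfRec Θ._<_ (λ _ → Pκλ → Maybe K) η → Pκλ → Maybe K
        step η rec a = next (char (Agree η (λ ε ε<η → rec ε<η) a)) a

        step-ext : ∀ η {rec rec′ : WfRec Θ._<_ (λ _ → Pκλ → Maybe K) η} →
                   (∀ {ε} ε<η → rec {ε} ε<η ≡ rec′ ε<η) → step η rec ≡ step η rec′
        step-ext η eq = cong (λ r a → next (char (Agree η r a)) a) (ext λ ε → ext λ ε<η → eq ε<η)

        x : Θ.Carrier → Pκλ → Maybe K
        x = All.wfRec Θ.wellFounded _ (λ _ → Pκλ → Maybe K) step

        Class : Θ.Carrier → Pκλ → Pred Pκλ _
        Class η = Agree η (λ ε _ → x ε)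

        class : Θ.Carrier → Pκλ → 𝒫 Pκλ
        class η a = char (Class η a)

        x-unfold : ∀ η a → x η a ≡ next (class η a) a
        x-unfold η a = cong (λ f → f a)
          (FixPoint.unfold-wfRec Θ.wellFounded (λ _ → Pκλ → Maybe K) step step-ext)

        class-≡ : ∀ {η a b} → (∀ ε → ε Θ.< η → x ε a ≡ x ε b) → class η a ≡ class η b
        class-≡ {η} {a} {b} eq = 𝒫-ext
          ( (λ {c} c∈ → let c∈A , agree = char⁻ (Class η a) {c} c∈ in
              char⁺ (Class η b) {c} (c∈A , λ ε ε<η → trans (agree ε ε<η) (eq ε ε<η)))
          , (λ {c} c∈ → let c∈A , agree = char⁻ (Class η b) {c} c∈ in
              char⁺ (Class η a) {c} (c∈A , λ ε ε<η → trans (agree ε ε<η) (sym (eq ε ε<η)))) )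

        Reaches : Θ.Carrier → K → Pred Pκλ _
        Reaches η γ a = ∃[ α ] (α < γ × x η a ≡ just α)

        -- The bound `γ` is uniform in `a`: it places the sequences of a stage in a single ^η γ, to
        -- which `no-injection` applies.
        AlmostAllReach : Θ.Carrier → Set _
        AlmostAllReach η = ∃[ γ ] Null (λ a → a ∈ ⟪ A ⟫ × ¬ Reaches η γ a)

        module Stage (η : Θ.Carrier) (below : ∀ {ε} → ε Θ.< η → AlmostAllReach ε) where

          level : Θ.↓ η → K
          level ε = proj₁ (below (prf ε))

          γ : K
          γ = proj₁ (bound (Θ↓-small {η}) level)

          level<γ : ∀ ε → level ε < γ
          level<γ = proj₂ (bound (Θ↓-small {η}) level)

          Regular : Pred Pκλ _
          Regular a = a ∈ ⟪ A ⟫ × (∀ ε → ε Θ.< η → Reaches ε γ a)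

          irregular-null : Null (λ a → a ∈ ⟪ A ⟫ × ¬ Regular a)
          irregular-null = Null-⊆ stuck (Null-⋃ (Θ↓-small {η}) λ ε → proj₂ (below (prf ε)))
            where
            Stuck : Θ.↓ η → Pred Pκλ _
            Stuck ε a = a ∈ ⟪ A ⟫ × ¬ Reaches (value ε) (level ε) a
            stuck : ∀ {a} → a ∈ ⟪ A ⟫ × ¬ Regular a → ∃[ ε ] Stuck ε a
            stuck {a} (a∈A , irregular) = byContradiction λ none → irregular (a∈A , λ ε ε<η →
              let α , α< , eq = byContradiction {A = Reaches ε (level (ε , [ ε<η ])) a} λ ¬reaches →
                    none ((ε , [ ε<η ]) , a∈A , ¬reaches)
              in α , <-trans α< (level<γ (ε , [ ε<η ])) , eq)

          node : Pκλ → V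
          node a = cut η λ ε → fromMaybe k₀ (x ε a)

          node-bounded : ∀ {a} → Regular a → Bounded η γ (node a)
          node-bounded (_ , reach) = cut-bounded λ ε ε<η →
            let α , α<γ , eq = reach ε ε<η in subst (λ m → fromMaybe k₀ m < γ) (sym eq) α<γ

          node-≡ : ∀ {a b} → Regular a → Regular b → node a ≡ node b → ∀ ε → ε Θ.< η → x ε a ≡ x ε b
          node-≡ {a} {b} (_ , reach-a) (_ , reach-b) eq ε ε<η =
            let α , _ , xa = reach-a ε ε<η
                β , _ , xb = reach-b ε ε<η
            in trans xa (trans (cong just
                 (trans (cong (fromMaybe k₀) (sym xa))
                   (trans (sym (cut-< (λ ε → fromMaybe k₀ (x ε a)) ε<η))
                     (trans (cong (λ v → v ε) eq)
                       (trans (cut-< (λ ε → fromMaybe k₀ (x ε b)) ε<η) (cong (fromMaybe k₀) xb))))))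
                 (sym xb))

          Node : Set _
          Node = [ v ∈ V ∣ (∃[ a ] (Regular a × node a ≡ v)) ]

          Node-small : Small Node
          Node-small K≤Node = no-injection η γ (value ∘ Injection.to K≤Node)
            (λ i → let a , regular-a , eq = prf (Injection.to K≤Node i) in
              subst (Bounded η γ) eq (node-bounded regular-a))
            λ eq → ≤ᶜ-injective K≤Node (value-injective eq)

          -- Membership proofs are irrelevant, so `prf n` returns one regular point per node,
          -- whichever point the node came from.
          block : Node → 𝒫 Pκλ
          block n = class η (proj₁ (prf n))

          block⊆A : ∀ n → ⟪ block n ⟫ ⊆ ⟪ A ⟫
          block⊆A n {a} a∈ = proj₁ (char⁻ (Class η (proj₁ (prf n))) {a} a∈)

          red-bound : ∀ n → ∃[ δ ] Null (Free (block n) δ)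
          red-bound n = eventually-red ¬free {block n} (block⊆A n)

          δ : Node → K
          δ n = proj₁ (red-bound n)

          -- A point outside `Free` has a red `ξ < δ n` below its `sup`. If it also includes the
          -- fewer than κ representatives below `δ n`, then `ξ` is good, and the least good ordinal
          -- is no larger.
          block-null : ∀ n → Null (λ a → a ∈ ⟪ block n ⟫ × ¬ Reaches η (δ n) a)
          block-null n = Null-⊆ (reaches em) (Null-∪ (proj₂ (red-bound n))
            (Null-⋃ {P = λ ξ a → ¬ (pick (block n) (value ξ) ⊑ a)} (↓-small (δ n))
              λ ξ → Null-⋢ (pick (block n) (value ξ))))
            where
            Misses : Pred Pκλ _
            Misses a = ∃[ ξ ] ¬ (pick (block n) (value {P = _< δ n} ξ) ⊑ a)
            contained : ∀ {a} → ¬ Misses a → ∀ ξ → ξ < δ n → pick (block n) ξ ⊑ a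
            contained {a} ¬misses ξ ξ<δ = byContradiction {A = pick (block n) ξ ⊑ a}
              (λ ¬⊑ → ¬misses ((ξ , [ ξ<δ ]) , ¬⊑))
            same : ∀ {a} → a ∈ ⟪ block n ⟫ → class η a ≡ block n
            same {a} a∈ = class-≡ (proj₂ (char⁻ (Class η (proj₁ (prf n))) {a} a∈))
            x-next : ∀ {a α} → a ∈ ⟪ block n ⟫ → next (block n) a ≡ just α → x η a ≡ just α
            x-next {a} a∈ eq = trans (x-unfold η a) (trans (cong (λ B → next B a) (same a∈)) eq)
            reach : ∀ {a} → a ∈ ⟪ block n ⟫ → ¬ Misses a →
              ∀ ξ → Over (block n) ξ → ξ < δ n → ξ < sup a → Red ξ (sup a) → Reaches η (δ n) a
            reach {a} a∈ ¬misses ξ over ξ<δ ξ<a red =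
              let pick∈ , sup≡ = pick-spec {block n} over
                  α , ξ≮α , eq = next-≤ {block n} {a} {ξ} (pick∈ , sup≡ , contained {a} ¬misses ξ ξ<δ , ξ<a , red)
              in α , ≮-<-trans ξ≮α ξ<δ , x-next a∈ eq
            reaches : ∀ {a} → Dec (Misses a) → a ∈ ⟪ block n ⟫ × ¬ Reaches η (δ n) a →
                      Free (block n) (δ n) a ⊎ Misses a
            reaches (yes misses) _             = inj₂ misses
            reaches (no ¬misses) (a∈ , ¬reach) = inj₁ (a∈ , λ ξ over ξ<δ ξ<a red →
              ¬reach (reach a∈ ¬misses ξ over ξ<δ ξ<a red))

          almostAllReach : AlmostAllReach η
          -- Having fewer than κ nodes serves twice: to bound the `δ n` and to unite the exceptional
          -- sets of the blocks.
          almostAllReach = let δ′ , δ<δ′ = bound Node-small δ in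
            δ′ , Null-⊆ (stuck δ<δ′ em) (Null-∪ irregular-null (Null-⋃ Node-small block-null))
            where
            Stuck : Node → Pred Pκλ _
            Stuck n a = a ∈ ⟪ block n ⟫ × ¬ Reaches η (δ n) a
            regular⇒node : ∀ {a} → Regular a → ∃[ n ] a ∈ ⟪ block n ⟫
            regular⇒node {a} regular-a = n ,
              (let r , regular-r , eq = prf n in
                char⁺ (Class η (proj₁ (prf n))) {a} (proj₁ regular-a , node-≡ regular-a regular-r (sym eq)))
              where
              n : Node
              n = node a , [ (a , regular-a , refl) ]
            stuck : ∀ {δ′} → (∀ n → δ n < δ′) → ∀ {a} → Dec (Regular a) → a ∈ ⟪ A ⟫ × ¬ Reaches η δ′ a →
                    (a ∈ ⟪ A ⟫ × ¬ Regular a) ⊎ ∃[ n ] Stuck n a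
            stuck δ<δ′ (no irregular)  (a∈A , _)      = inj₁ (a∈A , irregular)
            stuck δ<δ′ (yes regular-a) (a∈A , ¬reach) = let n , a∈ = regular⇒node regular-a in
              inj₂ (n , a∈ , λ (α , α<δ , eq) → ¬reach (α , <-trans α<δ (δ<δ′ n) , eq))

        almostAllReach : ∀ η → AlmostAllReach η
        almostAllReach = All.wfRec Θ.wellFounded _ AlmostAllReach λ η below → Stage.almostAllReach η below

        -- The exceptional sets of the θ stages are null and fewer than κ, so they cannot cover the
        -- positive set `A`.
        branch : ∃[ a ] (a ∈ ⟪ A ⟫ × (∀ η → ∃[ α ] x η a ≡ just α))
        branch = byContradiction λ none → A⁺ (Null⇒∈ (Null-⊆ (stuck none)
          (Null-⋃ Θ-small λ η → proj₂ (almostAllReach η))))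
          where
          Stuck : Θ.Carrier → Pred Pκλ _
          Stuck η a = a ∈ ⟪ A ⟫ × ¬ Reaches η (proj₁ (almostAllReach η)) a
          stuck : ¬ (∃[ a ] (a ∈ ⟪ A ⟫ × (∀ η → ∃[ α ] x η a ≡ just α))) → ∀ {a} → a ∈ ⟪ A ⟫ → ∃[ η ] Stuck η a
          stuck none {a} a∈A = byContradiction λ never → none (a , a∈A , λ η →
            let α , _ , eq = byContradiction {A = Reaches η (proj₁ (almostAllReach η)) a}
                  λ ¬reach → never (η , a∈A , ¬reach)
            in α , eq)

        chain : ∃[ l ] ((∀ (i : ∣ θ +1 ∣) → l i ∈ ⟪ A ⟫) ×
          (∀ {i j} → Ordinal._<_ (θ +1) i j → l i ≺ l j × Red (sup (l i)) (sup (l j))))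
        chain = link , link∈A , joined
          where
          tip : Pκλ
          tip = proj₁ branch
          tip∈A : tip ∈ ⟪ A ⟫
          tip∈A = proj₁ (proj₂ branch)
          α : Θ.Carrier → K
          α η = proj₁ (proj₂ (proj₂ branch) η)
          xa : ∀ η → x η tip ≡ just (α η)
          xa η = proj₂ (proj₂ (proj₂ branch) η)
          p : Θ.Carrier → Pκλ
          p η = pick (class η tip) (α η)
          -- A later link lies in the class of `tip` and so makes the same choice at `η`. Hence
          -- `p η` is good for it as well, which joins any two links and not only each link to
          -- `tip`.
          good : ∀ η b → x η b ≡ x η tip → class η b ≡ class η tip → Good (class η tip) b (α η)
          good η b eq same = next-good (trans (cong (λ B → next B b) (sym same))
            (trans (sym (x-unfold η b)) (trans eq (xa η))))
          p∈class : ∀ η → Class η tip (p η)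
          p∈class η = char⁻ (Class η tip) {p η} (proj₁ (good η tip refl refl))
          good⇒joined : ∀ η {b} → Good (class η tip) b (α η) → p η ≺ b × Red (sup (p η)) (sup b)
          good⇒joined η {b} (_ , sup≡ , ⊑b , α<b , red) =
            sup<⇒≺ {p η} {b} ⊑b (subst (_< sup b) (sym sup≡) α<b) , subst (λ σ → Red σ (sup b)) (sym sup≡) red
          link : ∣ θ +1 ∣ → Pκλ
          link ⊤⁺        = tip
          link Sup.[ η ] = p η
          link∈A : ∀ i → link i ∈ ⟪ A ⟫
          link∈A ⊤⁺        = tip∈A
          link∈A Sup.[ η ] = proj₁ (p∈class η)
          joined : ∀ {i j} → Ordinal._<_ (θ +1) i j → link i ≺ link j × Red (sup (link i)) (sup (link j))
          joined Strict.[ η ]<⊤⁺ = good⇒joined η (good η tip refl refl)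
          joined (Strict.[_] {ε} {η} ε<η) = good⇒joined ε (good ε (p η) (proj₂ (p∈class η) ε ε<η)
            (class-≡ λ ε′ ε′<ε → proj₂ (p∈class η) ε′ (Θ.<-trans ε′<ε ε<η)))

-- From free sets and chains to the partition relation

theorem11p4 : (∀ {ℓ} → ExcludedMiddle ℓ) →
    (∀ {ℓ₁ ℓ₂} → Extensionality ℓ₁ ℓ₂) →
    ∀ {u : Level} (κ Λ θ : Ordinal u) →
    IsRegularUncountableCardinal κ →
    IsCardinal Λ →
    (κ<Λ : κ <ₒ Λ) →
    IsInfiniteCardinal θ →
    θ <ₒ κ →
    OnCardinal.Arrow κ θ →
    let open OnPκλ κ Λ κ<Λ in
    ∀ H → IsFineCompleteIdeal H →
    ∀ (cofH non : Set u) → IsCof H cofH → OnCardinal.IsNonWeaklySelective κ non → cofH <ᶜ non →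
    Arrowκκ H (θ +1)
theorem11p4 em ext {u} κ Λ θ regular _ κ<Λ θ-cardinal θ<κ arrow H H-ideal cofH non cof-H non-ws cofH<non F A A⁺ =
  homogeneous em
  where
  open Classical em ext
  open Pκλ-Ideal κ Λ regular κ<Λ
  open WellOrder κ using (<-asym) renaming (Carrier to K)

  -- `F` is defined only on its domain; quantifying over `p` makes colour 1 a relation on all pairs
  -- from `K`.
  Red : K → K → Set u
  Red σ τ = ∃[ p ] (value p ≡ (σ , τ) × F p ≡ 1F)

  HasFree : Set u
  HasFree = HasFreeSubset H H-ideal cofH non cof-H non-ws cofH<non Red A

  sup-pair : ∀ {B σ τ} → (σ , τ) ∈ [ B ]²κκ →
    ∃[ a ] ∃[ b ] (a ∈ ⟪ B ⟫ × b ∈ ⟪ B ⟫ × (σ , τ) ≡ (sup a , sup b) × Ordinal._<_ κ (sup a) (sup b))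
  sup-pair (a , b , a∈B , b∈B , is-σ , is-τ , σ<τ)
    with Is⋃∩κ-unique {a} is-σ (sup-spec a) | Is⋃∩κ-unique {b} is-τ (sup-spec b)
  ... | refl | refl = a , b , a∈B , b∈B , refl , σ<τ

  ≢1⇒≡0 : ∀ {i : Fin 2} → i ≢ 1F → i ≡ 0F
  ≢1⇒≡0 {0F} _  = refl
  ≢1⇒≡0 {1F} ≢1 = ⊥-elim (≢1 refl)

  homogeneous : Dec HasFree →
    ∃[ B ] ( ⟪ B ⟫ ⊆ ⟪ A ⟫
           × ( (B ∈ H ⁺ᴵ × Constant F [ B ]²κκ 0F)
             ⊎ (HasOrderType B _≺_ (θ +1) × Constant F [ B ]²κκ 1F) ) )
  homogeneous (yes (B , B⊆A , B⁺ , free)) = B , B⊆A , inj₁ (B⁺ , λ p p∈ → ≢1⇒≡0 λ Fp≡1 →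
    let a , b , a∈B , b∈B , eq , lt = sup-pair {B} p∈ in free a∈B b∈B lt (p , eq , Fp≡1))
  homogeneous (no ¬free) = image link , image⊆A , inj₂
    ( image-hasOrderType (θ +1) (λ {a} {b} a≺b b≺a → <-asym (≺⇒sup< {a} {b} a≺b) (≺⇒sup< {b} {a} b≺a))
        link (λ i<j → proj₁ (joined i<j))
    , constant )
    where
    open Tree H H-ideal cofH non cof-H non-ws cofH<non Red θ θ-cardinal θ<κ arrow A A⁺ ¬free using (chain)
    link : ∣ θ +1 ∣ → Pκλ
    link = proj₁ chain
    joined = proj₂ (proj₂ chain)
    image⊆A : ⟪ image link ⟫ ⊆ ⟪ A ⟫
    image⊆A {a} a∈ = let i , eq = char⁻ (Image link) {a} a∈ in subst (λ b → b ∈ ⟪ A ⟫) eq (proj₁ (proj₂ chain) i)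
    red-on-chain : ∀ i j → Ordinal._<_ κ (sup (link i)) (sup (link j)) → Red (sup (link i)) (sup (link j))
    -- `sup` increases strictly along the chain, so the order of the two values forces the order of
    -- the indices.
    red-on-chain i j lt with IsStrictTotalOrder.compare (Ordinal.isStrictTotalOrder (θ +1)) i j
    ... | tri< i<j _ _ = proj₂ (joined i<j)
    ... | tri≈ _ refl _ = ⊥-elim (<-asym lt lt)
    ... | tri> _ _ j<i = ⊥-elim (<-asym lt (≺⇒sup< {link j} {link i} (proj₁ (joined j<i))))
    constant : Constant F [ image link ]²κκ 1F
    constant p p∈ =
      let a , b , a∈ , b∈ , eq , lt = sup-pair {image link} p∈
          i , ci≡a = char⁻ (Image link) {a} a∈
          j , cj≡b = char⁻ (Image link) {b} b∈
          q , q≡ , Fq≡1 = subst₂ (λ a b → Red (sup a) (sup b)) ci≡a cj≡b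
            (red-on-chain i j (subst₂ (λ a b → Ordinal._<_ κ (sup a) (sup b)) (sym ci≡a) (sym cj≡b) lt))
      in trans (cong F (value-injective (trans eq (sym q≡)))) Fq≡1
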